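{- Let $n \in \mathbb{N}$ and $z \in \mathbb{C}$ such that $\Re(z) \in \mathbb{R} \setminus \{0\}$. Define $$\phi_n(z) = \sum_{k \in \mathbb{Z}} \frac{1}{k^{2^n} + z^{2^n}}.$$ Then the following recursive relation holds: $$\phi_n(z) = \frac{\phi_{n-1}\left(i^{3 \cdot 2^{1-n}} z\right) - \phi_{n-1}\left(i^{2^{1-n}} z\right)}{2 i\, z^{2^{n-1}}},$$ where $i = \sqrt{ -1}$.
   Context: $\mathbb{N}$ denotes the positive integers, and $\phi_{n-1}$ is given by the same series with $n$ replaced by $n-1$, i.e. $\phi_{n-1}(w) = \sum_{k \in \mathbb{Z}} \frac{1}{k^{2^{n-1}} + w^{2^{n-1}}}$.
   Formalization: The formal theorem also assumes that no term of the series for φ_n(z) has zero denominator; Re(z) ≠ 0 does not ensure this for n ≥ 2 (for n = 2, z = e^{iπ/4}, k = 1 the denominator is 0). The sum over k in Z is the limit of symmetric partial sums. -}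

module Defs where

open import Algebra.Apartness.Bundles using (HeytingCommutativeRing; HeytingField)
open import Algebra.Bundles using (CommutativeRing)
open import Algebra.Bundles.Raw using (RawRing)
import Algebra.Definitions.RawMonoid as RawMonoidDefs
import Algebra.Definitions.RawSemiring as RawSemiringDefs
open import Data.Integer.Base using (ℤ; +_; -[1+_])
open import Data.Nat.Base as ℕ using (ℕ; zero; suc; NonZero; _≥_; _!)
open import Data.Nat.Properties using (_!≢0; m^n≢0)
open import Data.Product.Base using (∃-syntax; Σ-syntax; _×_; proj₁; proj₂)
open import Data.Sum.Base using (_⊎_)
open import Level using (Level; _⊔_) renaming (suc to lsuc)
open import Relation.Binary.Core using (Rel)
open import Relation.Binary.Structures using (IsStrictPartialOrder)
open import Relation.Nullary.Negation using (¬_)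

-- The real numbers, given axiomatically: a Cauchy-complete Archimedean ordered
-- field.  Over classical logic this determines ℝ up to isomorphism (with # the
-- negation of ≈); the axioms are phrased so that the Cauchy and Dedekind reals
-- of constructive mathematics satisfy them too.
record RealField (c ℓ₁ ℓ₂ : Level) : Set (lsuc (c ⊔ ℓ₁ ⊔ ℓ₂)) where
  field
    heytingField : HeytingField c ℓ₁ ℓ₂

  open HeytingField heytingField public
  open HeytingCommutativeRing heytingCommutativeRing using (commutativeRing)
  open CommutativeRing commutativeRing using (+-rawMonoid)
  open RawMonoidDefs +-rawMonoid public using () renaming (_×_ to _·_)

  infix 4 _<_ _≤_
  field
    _<_                  : Rel Carrier ℓ₂
    isStrictPartialOrder : IsStrictPartialOrder _≈_ _<_
    <⇒#                  : ∀ {x y} → x < y → x # y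
    #⇒<⊎>                : ∀ {x y} → x # y → x < y ⊎ y < x
    0<1                  : 0# < 1#
    +-monoˡ-<            : ∀ {x y} z → x < y → x + z < y + z
    *-pos                : ∀ {x y} → 0# < x → 0# < y → 0# < x * y

  _≤_ : Rel Carrier ℓ₂
  x ≤ y = ¬ (y < x)

  -- |x - y| < ε
  Near : Carrier → Rel Carrier ℓ₂
  Near ε x y = (x < y + ε) × (y < x + ε)

  IsCauchy : (ℕ → Carrier) → Set (c ⊔ ℓ₂)
  IsCauchy s = ∀ ε → 0# < ε → ∃[ N ] ∀ m n → m ≥ N → n ≥ N → Near ε (s m) (s n)

  IsLimit : (ℕ → Carrier) → Carrier → Set (c ⊔ ℓ₂)
  IsLimit s L = ∀ ε → 0# < ε → ∃[ N ] ∀ m → m ≥ N → Near ε (s m) L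

  field
    archimedean : ∀ x → ∃[ n ] x < n · 1#
    complete    : ∀ s → IsCauchy s → ∃[ L ] IsLimit s L

module RealProperties {c ℓ₁ ℓ₂} (R : RealField c ℓ₁ ℓ₂) where
  open RealField R
  private module < = IsStrictPartialOrder isStrictPartialOrder

  recip : ∀ x → x # 0# → Carrier
  recip x x#0 = proj₁ (#⇒invertible x#0)   -- the inverse of x - 0#

  fromℕ : ℕ → Carrier
  fromℕ n = n · 1#

  fromℕ-pos : ∀ n .{{_ : NonZero n}} → 0# < fromℕ n
  fromℕ-pos (suc zero)    = <.<-respʳ-≈ (sym (+-identityʳ 1#)) 0<1
  fromℕ-pos (suc (suc n)) =
    <.trans 0<1
      (<.<-respʳ-≈ (+-comm (fromℕ (suc n)) 1#)
        (<.<-respˡ-≈ (+-identityˡ 1#)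
          (+-monoˡ-< 1# (fromℕ-pos (suc n)))))

  1/ℕ : ∀ n .{{_ : NonZero n}} → Carrier
  1/ℕ n = recip (fromℕ n) (#-sym (<⇒# (fromℕ-pos n)))

module Complex {c ℓ₁ ℓ₂} (R : RealField c ℓ₁ ℓ₂) where
  private module ℝ where
    open RealField R public
    open RealProperties R public

  infix 6 _+i_
  record ℂ : Set c where
    constructor _+i_
    field
      re im : ℝ.Carrier
  open ℂ public

  ℂ-rawRing : RawRing c ℓ₁
  ℂ-rawRing = record
    { Carrier = ℂ
    ; _≈_     = λ x y → (re x ℝ.≈ re y) × (im x ℝ.≈ im y)
    ; _+_     = λ x y → (re x ℝ.+ re y) +i (im x ℝ.+ im y)
    ; _*_     = λ x y → (re x ℝ.* re y ℝ.- im x ℝ.* im y)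
                        +i (re x ℝ.* im y ℝ.+ im x ℝ.* re y)
    ; -_      = λ x → (ℝ.- re x) +i (ℝ.- im x)
    ; 0#      = ℝ.0# +i ℝ.0#
    ; 1#      = ℝ.1# +i ℝ.0#
    }

  open RawRing ℂ-rawRing public using (_≈_; _+_; _*_; -_; 0#; 1#)
  open RawRing ℂ-rawRing using (rawSemiring)
  open RawSemiringDefs rawSemiring public using (_^_)

  infixl 6 _-_
  _-_ : ℂ → ℂ → ℂ
  x - y = x + (- y)

  i : ℂ
  i = ℝ.0# +i ℝ.1#

  ofReal : ℝ.Carrier → ℂ
  ofReal a = a +i ℝ.0#

  fromℕ : ℕ → ℂ
  fromℕ n = ofReal (ℝ.fromℕ n)

  fromℤ : ℤ → ℂ
  fromℤ (+ n)    = fromℕ n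
  fromℤ -[1+ n ] = - fromℕ (suc n)

  normSq : ℂ → ℝ.Carrier
  normSq x = re x ℝ.* re x ℝ.+ im x ℝ.* im x

  -- x ≠ 0, in the form |x|² # 0.
  infix 4 _#0
  _#0 : ℂ → Set ℓ₂
  x #0 = normSq x ℝ.# ℝ.0#

  re#0 : ℂ → Set ℓ₂
  re#0 x = re x ℝ.# ℝ.0#

  -- conj x / |x|²
  recip : ∀ x → x #0 → ℂ
  recip x x#0 = (re x +i (ℝ.- im x)) * ofReal (ℝ.recip (normSq x) x#0)

  -- |s m - L| < ε is written |s m - L|² < ε² to avoid square roots.
  Converges : (ℕ → ℂ) → ℂ → Set (c ⊔ ℓ₂)
  Converges s L = ∀ ε → ℝ.0# ℝ.< ε →
    ∃[ N ] ∀ m → m ≥ N → normSq (s m - L) ℝ.< ε ℝ.* ε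

  partialSum : (ℕ → ℂ) → ℕ → ℂ
  partialSum t zero    = 0#
  partialSum t (suc m) = partialSum t m + t m

  -- The sum over -m ≤ k ≤ m.
  symmetricSum : (ℤ → ℂ) → ℕ → ℂ
  symmetricSum t zero    = t (+ 0)
  symmetricSum t (suc m) = symmetricSum t m + (t (+ suc m) + t -[1+ m ])

  expTerm : ℂ → ℕ → ℂ
  expTerm x k = x ^ k * ofReal (ℝ.1/ℕ (k !) {{k !≢0}})

  -- IsExp x y : exp x = y
  IsExp : ℂ → ℂ → Set (c ⊔ ℓ₂)
  IsExp x y = Converges (partialSum (expTerm x)) y

  -- cos x = 0 for real x, using cos x = Re (exp (ix)).
  CosVanishes : ℝ.Carrier → Set (c ⊔ ℓ₁ ⊔ ℓ₂)
  CosVanishes x = ∃[ y ] IsExp (i * ofReal x) y × re y ℝ.≈ ℝ.0#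

  -- π is twice the least positive zero of cos.
  IsPi : ℝ.Carrier → Set (c ⊔ ℓ₁ ⊔ ℓ₂)
  IsPi π = ∃[ h ] (π ℝ.≈ h ℝ.+ h) × (ℝ.0# ℝ.< h) × CosVanishes h
         × (∀ y → ℝ.0# ℝ.< y → y ℝ.< h → ¬ CosVanishes y)

  -- IsLog x ℓ : ℓ is the principal logarithm of x, with -π < Im ℓ ≤ π.
  IsLog : ℂ → ℂ → Set (c ⊔ ℓ₁ ⊔ ℓ₂)
  IsLog x ℓ = IsExp ℓ x
            × ∃[ π ] IsPi π × (ℝ.- π ℝ.< im ℓ) × (im ℓ ℝ.≤ π)

  -- IsPow x a y : y is the principal value of xᵃ, that is exp (a Log x).
  IsPow : ℂ → ℂ → ℂ → Set (c ⊔ ℓ₁ ⊔ ℓ₂)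
  IsPow x a y = ∃[ ℓ ] IsLog x ℓ × IsExp (a * ℓ) y

  -- 2⁻ᵐ
  2^-_ : ℕ → ℂ
  2^- m = ofReal (ℝ.1/ℕ (2 ℕ.^ m) {{m^n≢0 2 m}})

  φ-denominator : ℕ → ℂ → ℤ → ℂ
  φ-denominator n z k = fromℤ k ^ (2 ℕ.^ n) + z ^ (2 ℕ.^ n)

  -- Re z ≠ 0 alone ensures this only for n = 1: z = exp (iπ/4) is a pole of φ₂.
  PoleFree : ℕ → ℂ → Set ℓ₂
  PoleFree n z = ∀ k → φ-denominator n z k #0

  -- Isφ n z s : every term of the series for φₙ(z) is defined and the series
  -- has sum s.  The sum over ℤ is the limit of the symmetric partial sums; this
  -- matters only for n = 0, where the series 1/(k + z) does not converge
  -- absolutely.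
  Isφ : ℕ → ℂ → ℂ → Set (c ⊔ ℓ₂)
  Isφ n z s = Σ[ p ∈ PoleFree n z ]
    Converges (symmetricSum λ k → recip (φ-denominator n z k) (p k)) s

{-# OPTIONS --safe #-}
-- Write N = 2ⁿ⁻¹ and w = zᴺ.  Since exp (x + y) = exp x exp y, the numbers ω₁
-- and ω₃ satisfy ω₁ᴺ = i and ω₃ᴺ = i³ = -i, so k²ᴺ + z²ᴺ factors as
-- (kᴺ + (ω₃z)ᴺ) (kᴺ + (ω₁z)ᴺ) = (kᴺ - iw) (kᴺ + iw), and the recursion is the
-- partial fraction 1 / (kᴺ - iw) - 1 / (kᴺ + iw) = 2iw / (k²ᴺ + w²) summed over k.
--
-- The addition theorem: with Eₙ the n-th partial sum of exp, Eₙ(x) Eₙ(y) - Eₙ(x + y)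
-- is dominated termwise by the same expression in X ≥ |x| and Y ≥ |y|, which is
-- at most E₂ₙ(X + Y) - Eₙ(X + Y).  The series for φₙ with n ≥ 1 converges by
-- comparison with 1 / m - 1 / (m + 1) = 1 / m (m + 1); for n = 0 its symmetric
-- sums are multiples of those of φ₁.
module Submission where

open import Defs
open import Data.Nat.Base as ℕ using (ℕ; NonZero; pred)
open import Data.Product.Base using (∃-syntax; Σ-syntax; _×_)

open import Algebra.Apartness.Bundles using (HeytingField; HeytingCommutativeRing)
open import Algebra.Bundles using (CommutativeRing)
open import Algebra.Bundles.Raw using (RawRing)
open import Algebra.Solver.Ring.AlmostCommutativeRing using (_-Raw-AlmostCommutative⟶_; fromCommutativeRing)
open import Data.Empty using (⊥; ⊥-elim)
open import Data.Integer.Base as ℤ using (ℤ; +_; -[1+_]; _⊖_)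
import Data.Integer.Properties as ℤ
open import Data.Maybe.Base using (Maybe; just; nothing)
open import Data.Nat.Base using (zero; suc; _!; z≤n; s≤s)
import Data.Nat.Properties as ℕ
open import Data.Product.Base using (_,_; proj₁; proj₂)
open import Data.Sum.Base using ([_,_]′)
open import Function.Base using (_∘_)
import Relation.Binary.PropositionalEquality.Core as ≡
import Relation.Binary.Reasoning.Setoid as SetoidReasoning
open import Relation.Binary.Structures using (IsStrictPartialOrder; IsPreorder)
open import Relation.Nullary.Decidable.Core using (yes; no)

-- Why the index 2n appears: Eₙ(X) Eₙ(Y) sums XʲYᵏ / j!k! over the square j, k < n, while Eₙ(X + Y)
-- sums it over the triangle j + k < n. The difference is the far corner of the square, with
-- nonnegative terms, and the whole square lies in the triangle j + k < 2n. No binomial coefficient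
-- is ever estimated. Neither pole-freeness nor convergence is assumed for the two series of level n
-- - 1. A factor of a nonzero product is nonzero, which gives the former; the latter is proved for
-- each factor separately. The axioms for the reals are constructive and shape the estimates: x ≤ y
-- is the negation of y < x, signs cannot be decided in general, and no modulus |x| is formed.
-- Inequalities are therefore proved by exhibiting a difference of known sign, and complex numbers
-- are only compared with real bounds.

-- A ring solver with integer coefficients.

module ℤ-solver {a ℓ} (R : CommutativeRing a ℓ) where
  open CommutativeRing R
  open import Algebra.Properties.Ring ring
  open import Algebra.Properties.AbelianGroup +-abelianGroup using (⁻¹-∙-comm)
  open import Algebra.Properties.Semiring.Mult.TCOptimised semiring using (×-homo-+; ×1-homo-*; 1+×) renaming (_×_ to _·_)
  open import Relation.Binary.Reasoning.Setoid setoid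

  -- With the optimised multiples, the coefficients 0, 1 and 2 compute to `0#`, `1#` and `1# + 1#`,
  -- which is how the identities to be solved spell them.
  ⟦_⟧ : ℤ → Carrier
  ⟦ + n ⟧      = n · 1#
  ⟦ -[1+ n ] ⟧ = - (suc n · 1#)

  private
    cancel : ∀ x y z → x + y - (x + z) ≈ y - z
    cancel x y z = begin
      x + y - (x + z)       ≈⟨ +-cong (+-comm x y) (sym (⁻¹-∙-comm x z)) ⟩
      y + x + (- x + - z)   ≈⟨ +-assoc y x _ ⟩
      y + (x + (- x + - z)) ≈⟨ +-congˡ (sym (+-assoc x _ _)) ⟩
      y + (x - x + - z)     ≈⟨ +-congˡ (+-congʳ (-‿inverseʳ x)) ⟩
      y + (0# + - z)        ≈⟨ +-congˡ (+-identityˡ _) ⟩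
      y - z                 ∎

    ⊖-homo : ∀ m n → ⟦ m ⊖ n ⟧ ≈ m · 1# - n · 1#
    ⊖-homo zero    zero    = sym (-‿inverseʳ 0#)
    ⊖-homo zero    (suc n) = sym (+-identityˡ _)
    ⊖-homo (suc m) zero    = sym (trans (+-congˡ -0#≈0#) (+-identityʳ _))
    ⊖-homo (suc m) (suc n) = begin
      ⟦ suc m ⊖ suc n ⟧             ≈⟨ reflexive (≡.cong ⟦_⟧ (ℤ.[1+m]⊖[1+n]≡m⊖n m n)) ⟩
      ⟦ m ⊖ n ⟧                     ≈⟨ ⊖-homo m n ⟩
      m · 1# - n · 1#               ≈⟨ sym (cancel 1# _ _) ⟩
      1# + m · 1# - (1# + n · 1#)   ≈⟨ +-cong (sym (1+× m 1#)) (-‿cong (sym (1+× n 1#))) ⟩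
      suc m · 1# - suc n · 1#       ∎

    +-homo : ∀ i j → ⟦ i ℤ.+ j ⟧ ≈ ⟦ i ⟧ + ⟦ j ⟧
    +-homo (+ m)      (+ n)      = ×-homo-+ 1# m n
    +-homo (+ m)      (-[1+ n ]) = ⊖-homo m (suc n)
    +-homo (-[1+ m ]) (+ n)      = trans (⊖-homo n (suc m)) (+-comm _ _)
    +-homo (-[1+ m ]) (-[1+ n ]) = begin
      - (suc (suc (m ℕ.+ n)) · 1#)      ≈⟨ -‿cong (reflexive (≡.cong (λ k → suc k · 1#) (≡.sym (ℕ.+-suc m n)))) ⟩
      - ((suc m ℕ.+ suc n) · 1#)        ≈⟨ -‿cong (×-homo-+ 1# (suc m) (suc n)) ⟩
      - (suc m · 1# + suc n · 1#)       ≈⟨ sym (⁻¹-∙-comm _ _) ⟩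
      - (suc m · 1#) - suc n · 1#       ∎

    -‿homo : ∀ i → ⟦ ℤ.- i ⟧ ≈ - ⟦ i ⟧
    -‿homo (+ zero)   = sym -0#≈0#
    -‿homo (+ suc n)  = refl
    -‿homo (-[1+ n ]) = sym (-‿involutive _)

    *-homo⁺ : ∀ m j → ⟦ + m ℤ.* j ⟧ ≈ ⟦ + m ⟧ * ⟦ j ⟧
    *-homo⁺ m (+ n) = begin
      ⟦ + m ℤ.* + n ⟧     ≈⟨ reflexive (≡.cong ⟦_⟧ (≡.sym (ℤ.pos-* m n))) ⟩
      (m ℕ.* n) · 1#      ≈⟨ ×1-homo-* m n ⟩
      m · 1# * n · 1#     ∎
    *-homo⁺ m -[1+ n ] = begin
      ⟦ + m ℤ.* ℤ.- + suc n ⟧     ≈⟨ reflexive (≡.cong ⟦_⟧ (≡.sym (ℤ.neg-distribʳ-* (+ m) (+ suc n)))) ⟩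
      ⟦ ℤ.- (+ m ℤ.* + suc n) ⟧   ≈⟨ -‿homo (+ m ℤ.* + suc n) ⟩
      - ⟦ + m ℤ.* + suc n ⟧       ≈⟨ -‿cong (*-homo⁺ m (+ suc n)) ⟩
      - (m · 1# * suc n · 1#)     ≈⟨ -‿distribʳ-* _ _ ⟩
      m · 1# * - (suc n · 1#)     ∎

    *-homo : ∀ i j → ⟦ i ℤ.* j ⟧ ≈ ⟦ i ⟧ * ⟦ j ⟧
    *-homo (+ m)    j = *-homo⁺ m j
    *-homo -[1+ m ] j = begin
      ⟦ ℤ.- + suc m ℤ.* j ⟧     ≈⟨ reflexive (≡.cong ⟦_⟧ (≡.sym (ℤ.neg-distribˡ-* (+ suc m) j))) ⟩
      ⟦ ℤ.- (+ suc m ℤ.* j) ⟧   ≈⟨ -‿homo (+ suc m ℤ.* j) ⟩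
      - ⟦ + suc m ℤ.* j ⟧       ≈⟨ -‿cong (*-homo⁺ (suc m) j) ⟩
      - (suc m · 1# * ⟦ j ⟧)    ≈⟨ -‿distribˡ-* _ _ ⟩
      - (suc m · 1#) * ⟦ j ⟧    ∎

    ℤ-rawRing : RawRing _ _
    ℤ-rawRing = record
      { Carrier = ℤ ; _≈_ = ≡._≡_ ; _+_ = ℤ._+_ ; _*_ = ℤ._*_ ; -_ = ℤ.-_ ; 0# = + 0 ; 1# = + 1 }

    homomorphism : ℤ-rawRing -Raw-AlmostCommutative⟶ fromCommutativeRing R
    homomorphism = record
      { ⟦_⟧ = ⟦_⟧ ; +-homo = +-homo ; *-homo = *-homo ; -‿homo = -‿homo ; 0-homo = refl ; 1-homo = refl }

    _≟_ : ∀ i j → Maybe (⟦ i ⟧ ≈ ⟦ j ⟧)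
    i ≟ j with i ℤ.≟ j
    ... | yes i≡j = just (reflexive (≡.cong ⟦_⟧ i≡j))
    ... | no  _   = nothing

  open import Algebra.Solver.Ring ℤ-rawRing (fromCommutativeRing R) homomorphism _≟_ public
    using (solve; _:=_; con; _:+_; _:*_; _:-_; :-_)

-- Identities in an arbitrary commutative ring, shared by ℝ and ℂ.

module RingIdentities {a ℓ} (A : CommutativeRing a ℓ) where
  open CommutativeRing A
  open ℤ-solver A
  open import Algebra.Properties.Ring ring public using (-‿involutive; -‿distribˡ-*)

  x-0 : ∀ x → x ≈ x - 0#
  x-0 = solve 1 (λ x → x := x :- con (+ 0)) refl

  x-y+y : ∀ x y → x - y + y ≈ x
  x-y+y = solve 2 (λ x y → x :- y :+ y := x) refl

  [x-y]+[y-z] : ∀ x y z → x - y + (y - z) ≈ x - z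
  [x-y]+[y-z] = solve 3 (λ x y z → x :- y :+ (y :- z) := x :- z) refl

  [x-z]-[y-z] : ∀ x y z → x - z - (y - z) ≈ x - y
  [x-z]-[y-z] = solve 3 (λ x y z → x :- z :- (y :- z) := x :- y) refl

  neg-sub : ∀ x y → - (x - y) ≈ - x - - y
  neg-sub = solve 2 (λ x y → :- (x :- y) := :- x :- :- y) refl

  -[x-x-[y-z]] : ∀ x y z → - (x - x - (y - z)) ≈ y - z
  -[x-x-[y-z]] = solve 3 (λ x y z → :- (x :- x :- (y :- z)) := y :- z) refl

  [x-u]+[y-v] : ∀ x y u v → x - u + (y - v) ≈ x + y - (u + v)
  [x-u]+[y-v] = solve 4 (λ x y u v → x :- u :+ (y :- v) := x :+ y :- (u :+ v)) refl

  sub-* : ∀ x y u v → (x - u) * (y - v) + (u * (y - v) + (x - u) * v) ≈ x * y - u * v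
  sub-* = solve 4 (λ x y u v → (x :- u) :* (y :- v) :+ (u :* (y :- v) :+ (x :- u) :* v) := x :* y :- u :* v) refl

  0+[0--x] : ∀ x → x ≈ 0# + (0# - - x)
  0+[0--x] = solve 1 (λ x → x := con (+ 0) :+ (con (+ 0) :- :- x)) refl

  x-[x-y] : ∀ x y → x - (x - y) ≈ y
  x-[x-y] = solve 2 (λ x y → x :- (x :- y) := y) refl

  x+[y-z] : ∀ x y z → x + (y - z) ≈ y + x - z
  x+[y-z] = solve 3 (λ x y z → x :+ (y :- z) := y :+ x :- z) refl

  0≈0*x-0 : ∀ x → 0# ≈ 0# * x - 0#
  0≈0*x-0 = solve 1 (λ x → con (+ 0) := con (+ 0) :* x :- con (+ 0)) refl

  [xy][uv]≈[x[yv]]u : ∀ x y u v → x * y * (u * v) ≈ x * (y * v) * u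
  [xy][uv]≈[x[yv]]u = solve 4 (λ x y u v → x :* y :* (u :* v) := x :* (y :* v) :* u) refl

  [1+x]y : ∀ x y → (1# + x) * y ≈ y + x * y
  [1+x]y = solve 2 (λ x y → (con (+ 1) :+ x) :* y := y :+ x :* y) refl

  -‿square : ∀ x → - x * (- x * 1#) ≈ x * (x * 1#)
  -‿square = solve 1 (λ x → :- x :* (:- x :* con (+ 1)) := x :* (x :* con (+ 1))) refl

  cube : ∀ {x} → x * x ≈ - 1# → x * (x * (x * 1#)) ≈ - x
  cube {x} xx≈-1 = begin
    x * (x * (x * 1#))  ≈⟨ solve 1 (λ x → x :* (x :* (x :* con (+ 1))) := x :* x :* x) refl x ⟩
    x * x * x           ≈⟨ *-congʳ xx≈-1 ⟩
    - 1# * x            ≈⟨ solve 1 (λ x → :- con (+ 1) :* x := :- x) refl x ⟩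
    - x                 ∎
    where open SetoidReasoning setoid

  square-of-root : ∀ {x} → x * x ≈ - 1# → ∀ w → x * w * (x * w) ≈ - (w * w)
  square-of-root {x} xx≈-1 w = begin
    x * w * (x * w)     ≈⟨ solve 2 (λ x w → x :* w :* (x :* w) := x :* x :* (w :* w)) refl x w ⟩
    x * x * (w * w)     ≈⟨ *-congʳ xx≈-1 ⟩
    - 1# * (w * w)      ≈⟨ solve 1 (λ w → :- con (+ 1) :* (w :* w) := :- (w :* w)) refl w ⟩
    - (w * w)           ∎
    where open SetoidReasoning setoid

  conjugate-factors : ∀ {y v w} k → y ≈ - v → v * v ≈ - (w * w) → (k + y) * (k + v) ≈ k * k + w * w
  conjugate-factors {y} {v} {w} k y≈-v vv≈-ww = begin
    (k + y) * (k + v)     ≈⟨ *-congʳ (+-congˡ y≈-v) ⟩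
    (k + - v) * (k + v)   ≈⟨ solve 2 (λ k v → (k :+ :- v) :* (k :+ v) := k :* k :+ :- (v :* v)) refl k v ⟩
    k * k + - (v * v)     ≈⟨ +-congˡ (-‿cong vv≈-ww) ⟩
    k * k + - - (w * w)   ≈⟨ solve 2 (λ k w → k :* k :+ :- :- (w :* w) := k :* k :+ w :* w) refl k w ⟩
    k * k + w * w         ∎
    where open SetoidReasoning setoid

  inverse-unique : ∀ {x y z} → x * y ≈ 1# → x * z ≈ 1# → y ≈ z
  inverse-unique {x} {y} {z} xy≈1 xz≈1 = begin
    y            ≈⟨ sym (*-identityʳ y) ⟩
    y * 1#       ≈⟨ *-congˡ (sym xz≈1) ⟩
    y * (x * z)  ≈⟨ solve 3 (λ x y z → y :* (x :* z) := x :* y :* z) refl x y z ⟩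
    x * y * z    ≈⟨ *-congʳ xy≈1 ⟩
    1# * z       ≈⟨ *-identityˡ z ⟩
    z            ∎
    where open SetoidReasoning setoid

  -- Both `r` and `b * s` invert `a`. This rewrites the reciprocal of one factor over the common
  -- denominator: 1 / a = b / d.
  inverse-of-factor : ∀ {a b d r s} → a * b ≈ d → a * r ≈ 1# → d * s ≈ 1# → r ≈ b * s
  inverse-of-factor ab≈d ar≈1 ds≈1 = inverse-unique ar≈1 (trans (sym (*-assoc _ _ _)) (trans (*-congʳ ab≈d) ds≈1))

  conjugate-pair : ∀ {k k′ s s′} v → k′ ≈ - k → s′ ≈ s → (k + v) * s + (k′ + v) * s′ ≈ v * (s + s′)
  conjugate-pair {k} {k′} {s} {s′} v k′≈-k s′≈s = begin
    (k + v) * s + (k′ + v) * s′    ≈⟨ +-congˡ (*-cong (+-congʳ k′≈-k) s′≈s) ⟩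
    (k + v) * s + (- k + v) * s    ≈⟨ solve 3 (λ k v s → (k :+ v) :* s :+ (:- k :+ v) :* s := v :* (s :+ s)) refl k v s ⟩
    v * (s + s)                    ≈⟨ *-congˡ (+-congˡ (sym s′≈s)) ⟩
    v * (s + s′)                   ∎
    where open SetoidReasoning setoid

  -- When `s` is the reciprocal of (k + v) (k - v), this is the partial fraction 1 / (k - v) - 1 /
  -- (k + v) = 2v / (k² - v²).
  conjugate-difference : ∀ k v s → (k + v) * s - (k + - v) * s ≈ (1# + 1#) * v * s
  conjugate-difference = solve 3 (λ k v s → (k :+ v) :* s :- (k :+ :- v) :* s := con (+ 2) :* v :* s) refl

  [x+y]-x : ∀ x y → x + y - x ≈ y
  [x+y]-x = solve 2 (λ x y → x :+ y :- x := y) refl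

  interchange-sub : ∀ a b c d e f → a - b + ((c - d) + (e - f)) ≈ a + (c + e) - (b + (d + f))
  interchange-sub = solve 6 (λ a b c d e f → a :- b :+ ((c :- d) :+ (e :- f)) := a :+ (c :+ e) :- (b :+ (d :+ f))) refl

  distrib₃ : ∀ a x y z → a * x + a * (y + z) ≈ a * (x + (y + z))
  distrib₃ = solve 4 (λ a x y z → a :* x :+ a :* (y :+ z) := a :* (x :+ (y :+ z))) refl

  -- With x = m and y = m + 1 as numbers, this is 1 / m (m + 1) = 1 / m - 1 / (m + 1).
  inverse-difference : ∀ {m x y} → m * x ≈ 1# → (1# + m) * y ≈ 1# → x * y ≈ x - y
  inverse-difference {m} {x} {y} mx≈1 [1+m]y≈1 = begin
    x * y                              ≈⟨ solve 3 (λ m x y → x :* y := x :* ((con (+ 1) :+ m) :* y) :- m :* x :* y) refl m x y ⟩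
    x * ((1# + m) * y) - m * x * y     ≈⟨ +-cong (*-congˡ [1+m]y≈1) (-‿cong (*-congʳ mx≈1)) ⟩
    x * 1# - 1# * y                    ≈⟨ solve 2 (λ x y → x :* con (+ 1) :- con (+ 1) :* y := x :- y) refl x y ⟩
    x - y                              ∎
    where open SetoidReasoning setoid

  inverse-* : ∀ {a b x y} → a * x ≈ 1# → b * y ≈ 1# → a * b * (x * y) ≈ 1#
  inverse-* {a} {b} {x} {y} ax≈1 by≈1 = begin
    a * b * (x * y)    ≈⟨ solve 4 (λ a b x y → a :* b :* (x :* y) := a :* x :* (b :* y)) refl a b x y ⟩
    a * x * (b * y)    ≈⟨ *-cong ax≈1 by≈1 ⟩
    1# * 1#            ≈⟨ *-identityˡ 1# ⟩
    1#                 ∎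
    where open SetoidReasoning setoid

  inverse-*-cancel : ∀ {a x} b → a * x ≈ 1# → a * (b * x) ≈ b
  inverse-*-cancel {a} {x} b ax≈1 = begin
    a * (b * x)    ≈⟨ solve 3 (λ a b x → a :* (b :* x) := b :* (a :* x)) refl a b x ⟩
    b * (a * x)    ≈⟨ *-congˡ ax≈1 ⟩
    b * 1#         ≈⟨ *-identityʳ b ⟩
    b              ∎
    where open SetoidReasoning setoid

  quotient : ∀ {d c s r} → d ≈ c * s → c * r ≈ 1# → s ≈ d * r
  quotient {d} {c} {s} {r} d≈cs cr≈1 = sym (begin
    d * r          ≈⟨ *-congʳ d≈cs ⟩
    c * s * r      ≈⟨ solve 3 (λ c s r → c :* s :* r := s :* (c :* r)) refl c s r ⟩
    s * (c * r)    ≈⟨ *-congˡ cr≈1 ⟩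
    s * 1#         ≈⟨ *-identityʳ s ⟩
    s              ∎)
    where open SetoidReasoning setoid

  double-sub : ∀ x y → x - y + (x - y) ≈ (1# + 1#) * x - (1# + 1#) * y
  double-sub = solve 2 (λ x y → x :- y :+ (x :- y) := con (+ 2) :* x :- con (+ 2) :* y) refl

  -- With a = 1 + n: a² + u = a (a - 1) + (u + a), and the last bracket is nonnegative once - u ≤ a.
  -- So a² + u is at least a (a - 1), the denominator of a telescoping series.
  square-shift : ∀ n u → (1# + n) * (1# + n) + u ≈ (1# + n) * n + (u - - (1# + n))
  square-shift = solve 2 (λ n u → (con (+ 1) :+ n) :* (con (+ 1) :+ n) :+ u := (con (+ 1) :+ n) :* n :+ (u :- :- (con (+ 1) :+ n))) refl

  -x*-x : ∀ x → - x * - x ≈ x * x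
  -x*-x = solve 1 (λ x → :- x :* :- x := x :* x) refl

  0*0-1*1 : 0# * 0# - 1# * 1# ≈ - 1#
  0*0-1*1 = solve 0 (con (+ 0) :* con (+ 0) :- con (+ 1) :* con (+ 1) := :- con (+ 1)) refl

  0*1+1*0 : 0# * 1# + 1# * 0# ≈ - 0#
  0*1+1*0 = solve 0 (con (+ 0) :* con (+ 1) :+ con (+ 1) :* con (+ 0) := :- con (+ 0)) refl

-- Order, apartness and null sequences in the real field.

module RealLemmas {c ℓ₁ ℓ₂} (R : RealField c ℓ₁ ℓ₂) where
  open RealField R public
  open RealProperties R public

  ℝ-commutativeRing : CommutativeRing c ℓ₁
  ℝ-commutativeRing = HeytingCommutativeRing.commutativeRing heytingCommutativeRing
  open CommutativeRing ℝ-commutativeRing using (ring; semiring)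
  open ℤ-solver ℝ-commutativeRing
  open RingIdentities ℝ-commutativeRing public using (inverse-unique)
  open import Algebra.Apartness.Properties.HeytingCommutativeRing heytingCommutativeRing public
    using (x-0≈x; #-congʳ; x#0y#0→xy#0; invertibleˡ⇒#)
  open import Algebra.Properties.Semiring.Mult semiring using (×-homo-+; ×1-homo-*)
  module < = IsStrictPartialOrder isStrictPartialOrder
  import Relation.Binary.Reasoning.Setoid setoid as ≈-Reasoning

  *-recipʳ : ∀ x x#0 → x * recip x x#0 ≈ 1#
  *-recipʳ x x#0 = trans (*-congʳ (sym (x-0≈x x))) (proj₂ (proj₂ (#⇒invertible x#0)))

  -- y / (x y) is an inverse of `x`, and invertible elements are apart from 0.
  #0-*ˡ : ∀ {x y} → x * y # 0# → x # 0#
  #0-*ˡ {x} {y} xy#0 = invertibleˡ⇒# (y * r , (begin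
    y * r * (x - 0#)  ≈⟨ *-congˡ (x-0≈x x) ⟩
    y * r * x         ≈⟨ solve 3 (λ x y r → y :* r :* x := x :* y :* r) refl x y r ⟩
    x * y * r         ≈⟨ *-recipʳ _ xy#0 ⟩
    1#                ∎))
    where
    open ≈-Reasoning
    r = recip (x * y) xy#0

  #0-*ʳ : ∀ {x y} → x * y # 0# → y # 0#
  #0-*ʳ xy#0 = #0-*ˡ (#-congʳ (*-comm _ _) xy#0)

  <⇒≤ : ∀ {x y} → x < y → x ≤ y
  <⇒≤ = <.asym

  ≈⇒≤ : ∀ {x y} → x ≈ y → x ≤ y
  ≈⇒≤ x≈y = <.irrefl (sym x≈y)

  -- Since `≤` is a negation, the strict conclusion has to be extracted from `x < y`: by
  -- cotransitivity `z` is apart from `x` or from `y`, and apartness decides the order.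
  <-≤-trans : ∀ {x y z} → x < y → y ≤ z → x < z
  <-≤-trans {x} {y} {z} x<y y≤z = [ (λ x#z → [ (λ x<z → x<z) , (λ z<x → ⊥-elim (y≤z (<.trans z<x x<y))) ]′ (#⇒<⊎> x#z))
    , (λ z#y → [ (λ z<y → ⊥-elim (y≤z z<y)) , <.trans x<y ]′ (#⇒<⊎> z#y)) ]′ (#-cotrans (<⇒# x<y) z)

  ≤-<-trans : ∀ {x y z} → x ≤ y → y < z → x < z
  ≤-<-trans {x} {y} {z} x≤y y<z = [ (λ y#x → [ (λ y<x → ⊥-elim (x≤y y<x)) , (λ x<y → <.trans x<y y<z) ]′ (#⇒<⊎> y#x))
    , (λ x#z → [ (λ x<z → x<z) , (λ z<x → ⊥-elim (x≤y (<.trans y<z z<x))) ]′ (#⇒<⊎> x#z)) ]′ (#-cotrans (<⇒# y<z) x)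

  ≤-trans : ∀ {x y z} → x ≤ y → y ≤ z → x ≤ z
  ≤-trans x≤y y≤z z<x = y≤z (<-≤-trans z<x x≤y)

  ≤-antisym : ∀ {x y} → x ≤ y → y ≤ x → x ≈ y
  ≤-antisym x≤y y≤x = proj₁ (HeytingField.tight heytingField _ _) λ x#y → [ y≤x , x≤y ]′ (#⇒<⊎> x#y)

  ≤-isPreorder : IsPreorder _≈_ _≤_
  ≤-isPreorder = record { isEquivalence = isEquivalence ; reflexive = ≈⇒≤ ; trans = ≤-trans }

  module ≤-Reasoning where
    open import Relation.Binary.Reasoning.Base.Triple
      ≤-isPreorder <.asym <.trans <.<-resp-≈ <⇒≤ <-≤-trans ≤-<-trans public

  -- The order need not be decidable, but a contradiction may be derived by cases. That is enough
  -- for goals of the form `≤`, which are negations themselves.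
  trichotomy : ∀ x y → (x < y → ⊥) → (x ≈ y → ⊥) → (y < x → ⊥) → ⊥
  trichotomy x y ¬< ¬≈ ¬> = ¬≈ (≤-antisym ¬> ¬<)

  -- Reduces an inequality to naming the difference `p`; the equation is then left to the ring
  -- solver.
  ≤-by : ∀ {x y} p → 0# ≤ p → y ≈ x + p → x ≤ y
  ≤-by {x} {y} p 0≤p y≈x+p y<x = 0≤p (begin-strict
    p            ≈⟨ solve 2 (λ x p → p := x :+ p :+ :- x) refl x p ⟩
    x + p + - x  ≈⟨ +-congʳ (sym y≈x+p) ⟩
    y + - x      <⟨ +-monoˡ-< (- x) y<x ⟩
    x + - x      ≈⟨ -‿inverseʳ x ⟩
    0#           ∎)
    where open ≤-Reasoning

  <-by : ∀ {x y} p → 0# < p → y ≈ x + p → x < y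
  <-by {x} {y} p 0<p y≈x+p = begin-strict
    x       ≈⟨ sym (+-identityˡ x) ⟩
    0# + x  <⟨ +-monoˡ-< x 0<p ⟩
    p + x   ≈⟨ +-comm p x ⟩
    x + p   ≈⟨ sym y≈x+p ⟩
    y       ∎
    where open ≤-Reasoning

  0<y-x : ∀ {x y} → x < y → 0# < y - x
  0<y-x {x} {y} x<y = begin-strict
    0#     ≈⟨ sym (-‿inverseʳ x) ⟩
    x - x  <⟨ +-monoˡ-< (- x) x<y ⟩
    y - x  ∎
    where open ≤-Reasoning

  +-monoˡ-≤ : ∀ {x y} z → x ≤ y → x + z ≤ y + z
  +-monoˡ-≤ {x} {y} z x≤y y+z<x+z = x≤y (begin-strict
    y            ≈⟨ solve 2 (λ x z → x := x :+ z :+ :- z) refl y z ⟩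
    y + z + - z  <⟨ +-monoˡ-< (- z) y+z<x+z ⟩
    x + z + - z  ≈⟨ solve 2 (λ x z → x :+ z :+ :- z := x) refl x z ⟩
    x            ∎)
    where open ≤-Reasoning

  0≤y-x : ∀ {x y} → x ≤ y → 0# ≤ y - x
  0≤y-x {x} {y} x≤y = begin
    0#     ≈⟨ sym (-‿inverseʳ x) ⟩
    x - x  ≤⟨ +-monoˡ-≤ (- x) x≤y ⟩
    y - x  ∎
    where open ≤-Reasoning

  +-mono-≤ : ∀ {x y u v} → x ≤ y → u ≤ v → x + u ≤ y + v
  +-mono-≤ {x} {y} {u} {v} x≤y u≤v = begin
    x + u  ≤⟨ +-monoˡ-≤ u x≤y ⟩
    y + u  ≈⟨ +-comm y u ⟩
    u + y  ≤⟨ +-monoˡ-≤ y u≤v ⟩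
    v + y  ≈⟨ +-comm v y ⟩
    y + v  ∎
    where open ≤-Reasoning

  0≤x+y : ∀ {x y} → 0# ≤ x → 0# ≤ y → 0# ≤ x + y
  0≤x+y 0≤x 0≤y = ≤-trans (≈⇒≤ (sym (+-identityˡ 0#))) (+-mono-≤ 0≤x 0≤y)

  *-pos-neg : ∀ {x y} → 0# < x → y < 0# → x * y < 0#
  *-pos-neg {x} {y} 0<x y<0 = <-by (x * (0# - y)) (*-pos 0<x (0<y-x y<0))
    (solve 2 (λ x y → con (+ 0) := x :* y :+ x :* (con (+ 0) :- y)) refl x y)

  0≤x*y : ∀ {x y} → 0# ≤ x → 0# ≤ y → 0# ≤ x * y
  0≤x*y {x} {y} 0≤x 0≤y xy<0 = trichotomy 0# x
    (λ 0<x → trichotomy 0# y (λ 0<y → <.asym xy<0 (*-pos 0<x 0<y))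
      (λ 0≈y → <.irrefl (trans (*-congˡ (sym 0≈y)) (zeroʳ x)) xy<0) 0≤y)
    (λ 0≈x → <.irrefl (trans (*-congʳ (sym 0≈x)) (zeroˡ y)) xy<0) 0≤x

  0≤x*x : ∀ x → 0# ≤ x * x
  0≤x*x x xx<0 = trichotomy 0# x
    (λ 0<x → <.asym xx<0 (*-pos 0<x 0<x))
    (λ 0≈x → <.irrefl (trans (*-congʳ (sym 0≈x)) (zeroˡ x)) xx<0)
    (λ x<0 → <.asym xx<0 (<.<-respʳ-≈ (solve 1 (λ x → (con (+ 0) :- x) :* (con (+ 0) :- x) := x :* x) refl x)
                                      (*-pos (0<y-x x<0) (0<y-x x<0))))

  *-monoˡ-≤ : ∀ {x y} z → 0# ≤ z → x ≤ y → z * x ≤ z * y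
  *-monoˡ-≤ {x} {y} z 0≤z x≤y = ≤-by (z * (y - x)) (0≤x*y 0≤z (0≤y-x x≤y))
    (solve 3 (λ x y z → z :* y := z :* x :+ z :* (y :- x)) refl x y z)

  *-monoˡ-< : ∀ {x y} z → 0# < z → x < y → z * x < z * y
  *-monoˡ-< {x} {y} z 0<z x<y = <-by (z * (y - x)) (*-pos 0<z (0<y-x x<y))
    (solve 3 (λ x y z → z :* y := z :* x :+ z :* (y :- x)) refl x y z)

  *-mono-≤ : ∀ {x y u v} → 0# ≤ x → 0# ≤ v → x ≤ y → u ≤ v → x * u ≤ y * v
  *-mono-≤ {x} {y} {u} {v} 0≤x 0≤v x≤y u≤v = begin
    x * u  ≤⟨ *-monoˡ-≤ x 0≤x u≤v ⟩
    x * v  ≈⟨ *-comm x v ⟩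
    v * x  ≤⟨ *-monoˡ-≤ v 0≤v x≤y ⟩
    v * y  ≈⟨ *-comm v y ⟩
    y * v  ∎
    where open ≤-Reasoning

  *-cancelˡ-≤ : ∀ {x y} z → 0# < z → z * x ≤ z * y → x ≤ y
  *-cancelˡ-≤ z 0<z zx≤zy y<x = zx≤zy (*-monoˡ-< z 0<z y<x)

  -- A positive product is apart from 0, hence so is `y`; its sign can then be decided, and a
  -- negative one is refuted by `*-pos-neg`.
  *-cancelˡ-pos : ∀ {x y} → 0# < x → 0# < x * y → 0# < y
  *-cancelˡ-pos {x} {y} 0<x 0<xy =
    [ (λ y<0 → ⊥-elim (<.asym 0<xy (*-pos-neg 0<x y<0))) , (λ 0<y → 0<y) ]′ (#⇒<⊎> (#0-*ʳ (#-sym (<⇒# 0<xy))))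

  recip-pos : ∀ {x} x#0 → 0# < x → 0# < recip x x#0
  recip-pos x#0 0<x = *-cancelˡ-pos 0<x (<.<-respʳ-≈ (sym (*-recipʳ _ x#0)) 0<1)

  *-cancelˡ-< : ∀ {x y} z → 0# < z → z * x < z * y → x < y
  *-cancelˡ-< {x} {y} z 0<z zx<zy = <-by (y - x)
    (*-cancelˡ-pos 0<z (<.<-respʳ-≈ (solve 3 (λ x y z → z :* y :- z :* x := z :* (y :- x)) refl x y z) (0<y-x zx<zy)))
    (solve 2 (λ x y → y := x :+ (y :- x)) refl x y)

  square-mono-< : ∀ {x y} → 0# ≤ x → x < y → x * x < y * y
  square-mono-< {x} {y} 0≤x x<y = begin-strict
    x * x  ≤⟨ *-monoˡ-≤ x 0≤x (<⇒≤ x<y) ⟩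
    x * y  ≈⟨ *-comm x y ⟩
    y * x  <⟨ *-monoˡ-< y (≤-<-trans 0≤x x<y) x<y ⟩
    y * y  ∎
    where open ≤-Reasoning

  -- Contraposition of `square-mono-<`; it stands in for taking square roots.
  square-cancel-≤ : ∀ {x y} → 0# ≤ y → x * x ≤ y * y → x ≤ y
  square-cancel-≤ 0≤y xx≤yy y<x = xx≤yy (square-mono-< 0≤y y<x)

  #0⇒0<square : ∀ {x} → x # 0# → 0# < x * x
  #0⇒0<square {x} x#0 = [ (λ xx<0 → ⊥-elim (0≤x*x x xx<0)) , (λ 0<xx → 0<xx) ]′ (#⇒<⊎> (x#0y#0→xy#0 x#0 x#0))

  fromℕ-homo-+ : ∀ m n → fromℕ (m ℕ.+ n) ≈ fromℕ m + fromℕ n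
  fromℕ-homo-+ = ×-homo-+ 1#

  fromℕ-homo-* : ∀ m n → fromℕ (m ℕ.* n) ≈ fromℕ m * fromℕ n
  fromℕ-homo-* = ×1-homo-*

  0≤fromℕ : ∀ n → 0# ≤ fromℕ n
  0≤fromℕ zero    = ≈⇒≤ refl
  0≤fromℕ (suc n) = <⇒≤ (fromℕ-pos (suc n))

  fromℕ-mono-≤ : ∀ {m n} → m ℕ.≤ n → fromℕ m ≤ fromℕ n
  fromℕ-mono-≤ {m} {n} m≤n = ≤-by (fromℕ (n ℕ.∸ m)) (0≤fromℕ (n ℕ.∸ m))
    (trans (reflexive (≡.cong fromℕ (≡.sym (ℕ.m+[n∸m]≡n m≤n)))) (fromℕ-homo-+ m _))

  fromℕ-*-1/ℕ : ∀ n .{{_ : NonZero n}} → fromℕ n * 1/ℕ n ≈ 1#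
  fromℕ-*-1/ℕ n = *-recipʳ _ _

  1/ℕ-pos : ∀ n .{{_ : NonZero n}} → 0# < 1/ℕ n
  1/ℕ-pos n = recip-pos _ (fromℕ-pos n)

  1/ℕ-homo-* : ∀ m n .{{_ : NonZero m}} .{{_ : NonZero n}} .{{_ : NonZero (m ℕ.* n)}} → 1/ℕ (m ℕ.* n) ≈ 1/ℕ m * 1/ℕ n
  1/ℕ-homo-* m n = inverse-unique (fromℕ-*-1/ℕ (m ℕ.* n)) (begin
    fromℕ (m ℕ.* n) * (1/ℕ m * 1/ℕ n)     ≈⟨ *-congʳ (fromℕ-homo-* m n) ⟩
    fromℕ m * fromℕ n * (1/ℕ m * 1/ℕ n)   ≈⟨ solve 4 (λ a b c d → a :* b :* (c :* d) := a :* c :* (b :* d)) refl (fromℕ m) (fromℕ n) (1/ℕ m) (1/ℕ n) ⟩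
    fromℕ m * 1/ℕ m * (fromℕ n * 1/ℕ n)   ≈⟨ *-cong (fromℕ-*-1/ℕ m) (fromℕ-*-1/ℕ n) ⟩
    1# * 1#                               ≈⟨ *-identityˡ 1# ⟩
    1#                                    ∎)
    where open ≈-Reasoning

  Null : (ℕ → Carrier) → Set _
  Null r = ∀ ε → 0# < ε → ∃[ N ] ∀ n → n ℕ.≥ N → r n < ε

  C/n-null : ∀ C → Null (λ n → C * 1/ℕ (suc n))
  C/n-null C ε 0<ε with archimedean (C * recip ε (#-sym (<⇒# 0<ε)))
  -- The Archimedean `N` exceeds C / ε, so C < ε (n + 1) for all n ≥ N.
  ... | N , C/ε<N = N , λ n n≥N → *-cancelˡ-< (fromℕ (suc n)) (fromℕ-pos (suc n)) (begin-strict
    fromℕ (suc n) * (C * 1/ℕ (suc n))  ≈⟨ solve 3 (λ a C b → a :* (C :* b) := a :* b :* C) refl (fromℕ (suc n)) C (1/ℕ (suc n)) ⟩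
    fromℕ (suc n) * 1/ℕ (suc n) * C    ≈⟨ *-congʳ (fromℕ-*-1/ℕ (suc n)) ⟩
    1# * C                             ≈⟨ *-congʳ (sym (*-recipʳ ε _)) ⟩
    ε * r * C                          ≈⟨ solve 3 (λ ε r C → ε :* r :* C := ε :* (C :* r)) refl ε r C ⟩
    ε * (C * r)                        <⟨ *-monoˡ-< ε 0<ε C/ε<N ⟩
    ε * fromℕ N                        ≤⟨ *-monoˡ-≤ ε (<⇒≤ 0<ε) (fromℕ-mono-≤ (ℕ.m≤n⇒m≤1+n n≥N)) ⟩
    ε * fromℕ (suc n)                  ≈⟨ *-comm _ _ ⟩
    fromℕ (suc n) * ε                  ∎)
    where
    open ≤-Reasoning
    r = recip ε (#-sym (<⇒# 0<ε))

  abstract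
    -- Opaque: outside this block only the three laws below are available.
    half : Carrier → Carrier
    half x = x * 1/ℕ 2

    half+half : ∀ x → half x + half x ≈ x
    half+half x = begin
      -- `fromℕ 2` unfolds to `1# + (1# + 0#)`, which the solver expression copies.
      half x + half x        ≈⟨ solve 2 (λ x h → x :* h :+ x :* h := x :* ((con (+ 1) :+ (con (+ 1) :+ con (+ 0))) :* h)) refl x (1/ℕ 2) ⟩
      x * (fromℕ 2 * 1/ℕ 2)  ≈⟨ *-congˡ (fromℕ-*-1/ℕ 2) ⟩
      x * 1#                 ≈⟨ *-identityʳ x ⟩
      x                      ∎
      where open ≈-Reasoning

    half-pos : ∀ {x} → 0# < x → 0# < half x
    half-pos 0<x = *-pos 0<x (1/ℕ-pos 2)

    half-< : ∀ {x} → 0# < x → half x < x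
    half-< {x} 0<x = <-by (half x) (half-pos 0<x) (sym (half+half x))

  -- A positive `x` would exceed its own half, taken as ε.
  ≤-of-all-ε : ∀ {x} → (∀ ε → 0# < ε → x ≤ ε) → x ≤ 0#
  ≤-of-all-ε x≤ε 0<x = x≤ε _ (half-pos 0<x) (half-< 0<x)

  sub-≤ : ∀ {x y z} → x < y + z → x - y ≤ z
  sub-≤ {x} {y} {z} x<y+z = ≤-by _ (<⇒≤ (0<y-x x<y+z)) (solve 3 (λ x y z → z := x :- y :+ (y :+ z :- x)) refl x y z)

  neg-sub-≤ : ∀ {x y z} → y < x + z → - (x - y) ≤ z
  neg-sub-≤ {x} {y} {z} y<x+z = ≤-by _ (<⇒≤ (0<y-x y<x+z)) (solve 3 (λ x y z → z := :- (x :- y) :+ (x :+ z :- y)) refl x y z)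

  neg-≤ : ∀ {x y} → - x ≤ y → - y ≤ x
  neg-≤ {x} {y} -x≤y = ≤-by _ (0≤y-x -x≤y) (solve 2 (λ x y → x := :- y :+ (y :- :- x)) refl x y)

-- Cauchy products and the formal exponential series.

module Sequences {a ℓ} (A : CommutativeRing a ℓ) where
  open CommutativeRing A
  open ℤ-solver A
  open import Relation.Binary.Reasoning.Setoid setoid

  ∑ : (ℕ → Carrier) → ℕ → Carrier
  ∑ f zero    = 0#
  ∑ f (suc n) = ∑ f n + f n

  -- Σ_{j ≤ n} f j * g (n - j)
  conv : (ℕ → Carrier) → (ℕ → Carrier) → ℕ → Carrier
  conv f g zero    = f 0 * g 0
  conv f g (suc n) = f 0 * g (suc n) + conv (f ∘ suc) g n

  -- Σ_{j < n} f j * h (n - j)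
  conv⁺ : (ℕ → Carrier) → (ℕ → Carrier) → ℕ → Carrier
  conv⁺ f h zero    = 0#
  conv⁺ f h (suc n) = f 0 * h (suc n) + conv⁺ (f ∘ suc) h n

  ∑-cong : ∀ {f g} → (∀ j → f j ≈ g j) → ∀ n → ∑ f n ≈ ∑ g n
  ∑-cong f≈g zero    = refl
  ∑-cong f≈g (suc n) = +-cong (∑-cong f≈g n) (f≈g n)

  ∑-shift : ∀ f n → ∑ f (suc n) ≈ f 0 + ∑ (f ∘ suc) n
  ∑-shift f zero    = +-comm 0# (f 0)
  ∑-shift f (suc n) = trans (+-congʳ (∑-shift f n)) (+-assoc _ _ _)

  conv-cong : ∀ {f f′ g g′} → (∀ j → f j ≈ f′ j) → (∀ j → g j ≈ g′ j) → ∀ n → conv f g n ≈ conv f′ g′ n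
  conv-cong f≈f′ g≈g′ zero    = *-cong (f≈f′ 0) (g≈g′ 0)
  conv-cong f≈f′ g≈g′ (suc n) = +-cong (*-cong (f≈f′ 0) (g≈g′ (suc n))) (conv-cong (f≈f′ ∘ suc) g≈g′ n)

  conv-+ˡ : ∀ f f′ g n → conv (λ j → f j + f′ j) g n ≈ conv f g n + conv f′ g n
  conv-+ˡ f f′ g zero    = distribʳ _ _ _
  conv-+ˡ f f′ g (suc n) = trans (+-congˡ (conv-+ˡ (f ∘ suc) (f′ ∘ suc) g n))
    (solve 5 (λ a b x c d → (a :+ b) :* x :+ (c :+ d) := a :* x :+ c :+ (b :* x :+ d)) refl _ _ _ _ _)

  conv-*ˡ : ∀ x f g n → conv (λ j → x * f j) g n ≈ x * conv f g n
  conv-*ˡ x f g zero    = *-assoc _ _ _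
  conv-*ˡ x f g (suc n) = trans (+-congˡ (conv-*ˡ x (f ∘ suc) g n))
    (solve 4 (λ x a b c → x :* a :* b :+ x :* c := x :* (a :* b :+ c)) refl _ _ _ _)

  conv-*ʳ : ∀ x f g n → conv f (λ j → x * g j) n ≈ x * conv f g n
  conv-*ʳ x f g zero    = solve 3 (λ x a b → a :* (x :* b) := x :* (a :* b)) refl _ _ _
  conv-*ʳ x f g (suc n) = trans (+-congˡ (conv-*ʳ x (f ∘ suc) g n))
    (solve 4 (λ x a b c → a :* (x :* b) :+ x :* c := x :* (a :* b :+ c)) refl _ _ _ _)

  -- Both sides sum f j * g k over the triangle j + k < n, by rows on the left and by diagonals on
  -- the right.
  conv⁺-∑ : ∀ f g n → conv⁺ f (∑ g) n ≈ ∑ (conv f g) n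
  conv⁺-∑ f g zero    = refl
  conv⁺-∑ f g (suc n) = trans (+-congˡ (conv⁺-∑ (f ∘ suc) g n)) (sym (step n))
    where
    step : ∀ n → ∑ (conv f g) (suc n) ≈ f 0 * ∑ g (suc n) + ∑ (conv (f ∘ suc) g) n
    step zero    = solve 2 (λ a b → con (+ 0) :+ a :* b := a :* (con (+ 0) :+ b) :+ con (+ 0)) refl _ _
    step (suc n) = trans (+-congʳ (step n))
      (solve 5 (λ a s t b c → a :* s :+ t :+ (a :* b :+ c) := a :* (s :+ b) :+ (t :+ c)) refl _ _ _ _ _)

  -- Splits off j = 0 from Σ f j * (y - h (n - j)). When `h` consists of the partial sums of a
  -- series and `y` is a later one, every bracket is a block of that series, which can be estimated
  -- termwise.
  conv⁺-defect : ∀ f h y n → ∑ f (suc n) * y - conv⁺ f h (suc n)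
    ≈ f 0 * (y - h (suc n)) + (∑ (f ∘ suc) n * y - conv⁺ (f ∘ suc) h n)
  conv⁺-defect f h y n = trans (+-congʳ (*-congʳ (∑-shift f n)))
    (solve 5 (λ f₀ s y h c → (f₀ :+ s) :* y :- (f₀ :* h :+ c) := f₀ :* (y :- h) :+ (s :* y :- c)) refl _ _ _ _ _)

  module Exponential
    (ν : ℕ → Carrier) (ν-zero : ν 0 ≈ 0#) (ν-suc : ∀ n → ν (suc n) ≈ 1# + ν n)
    (ν⁻¹ : ℕ → Carrier) (ν-inverse : ∀ n → ν (suc n) * ν⁻¹ n ≈ 1#)
    where

    -- This is xⁿ / n!, in a recursive form free of powers and factorials; note that `ν⁻¹ n` inverts
    -- n + 1.
    e : Carrier → ℕ → Carrier
    e x zero    = 1#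
    e x (suc n) = x * e x n * ν⁻¹ n

    -- The coefficients of the formal derivative of Σ f n Xⁿ.
    D : (ℕ → Carrier) → ℕ → Carrier
    D f n = ν (suc n) * f (suc n)

    D-e : ∀ x n → D (e x) n ≈ x * e x n
    D-e x n = begin
      ν (suc n) * (x * e x n * ν⁻¹ n)  ≈⟨ solve 4 (λ a x y b → a :* (x :* y :* b) := a :* b :* (x :* y)) refl _ _ _ _ ⟩
      ν (suc n) * ν⁻¹ n * (x * e x n)  ≈⟨ *-congʳ (ν-inverse n) ⟩
      1# * (x * e x n)                 ≈⟨ *-identityˡ _ ⟩
      x * e x n                        ∎

    leibniz : ∀ f g n → D (conv f g) n ≈ conv (D f) g n + conv f (D g) n
    leibniz f g zero    = solve 5 (λ v f₀ f₁ g₀ g₁ → v :* (f₀ :* g₁ :+ f₁ :* g₀) := v :* f₁ :* g₀ :+ f₀ :* (v :* g₁)) refl _ _ _ _ _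
    leibniz f g (suc n) = begin
      ν (2 ℕ.+ n) * (f 0 * g (2 ℕ.+ n) + X)
        ≈⟨ distribˡ _ _ _ ⟩
      ν (2 ℕ.+ n) * (f 0 * g (2 ℕ.+ n)) + ν (2 ℕ.+ n) * X
        -- The weight n + 2 is split as (n + 1) + 1. The first part goes to the induction
        -- hypothesis; the extra copy of `X` is unfolded and finally merged into `D f` through
        -- `Df∘suc`.
        ≈⟨ +-congˡ (trans (*-congʳ (ν-suc (suc n))) (solve 2 (λ v x → (con (+ 1) :+ v) :* x := v :* x :+ x) refl (ν (suc n)) X)) ⟩
      ν (2 ℕ.+ n) * (f 0 * g (2 ℕ.+ n)) + (ν (suc n) * X + (f 1 * g (suc n) + conv f″ g n))
        ≈⟨ +-congˡ (+-congʳ (leibniz f′ g n)) ⟩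
      ν (2 ℕ.+ n) * (f 0 * g (2 ℕ.+ n)) + (conv (D f′) g n + conv f′ (D g) n + (f 1 * g (suc n) + conv f″ g n))
        ≈⟨ solve 8 (λ v f₀ g₂ p q f₁ g₁ r → v :* (f₀ :* g₂) :+ (p :+ q :+ (f₁ :* g₁ :+ r))
                      := f₁ :* g₁ :+ (p :+ r) :+ (f₀ :* (v :* g₂) :+ q)) refl _ _ _ _ _ _ _ _ ⟩
      f 1 * g (suc n) + (conv (D f′) g n + conv f″ g n) + conv f (D g) (suc n)
        ≈⟨ +-congʳ (+-cong (*-congʳ f1≈Df0) (sym (trans (conv-cong Df∘suc (λ _ → refl) n) (conv-+ˡ (D f′) f″ g n)))) ⟩
      conv (D f) g (suc n) + conv f (D g) (suc n) ∎
      where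
      f′ = f ∘ suc
      f″ = f′ ∘ suc
      X  = conv f′ g (suc n)
      f1≈Df0 : f 1 ≈ D f 0
      f1≈Df0 = sym (trans (*-congʳ (trans (ν-suc 0) (trans (+-congˡ ν-zero) (+-identityʳ 1#)))) (*-identityˡ _))
      Df∘suc : ∀ j → D f (suc j) ≈ D f′ j + f″ j
      Df∘suc j = trans (*-congʳ (ν-suc (suc j))) (solve 2 (λ v x → (con (+ 1) :+ v) :* x := v :* x :+ x) refl _ _)

    -- By the Leibniz rule, (n + 1) c (n + 1) = (x + y) c n for c = conv (e x) (e y).
    conv-e : ∀ x y n → conv (e x) (e y) n ≈ e (x + y) n
    conv-e x y zero    = *-identityˡ 1#
    conv-e x y (suc n) = begin
      C (suc n)                        ≈⟨ sym (*-identityˡ _) ⟩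
      1# * C (suc n)                   ≈⟨ *-congʳ (sym (ν-inverse n)) ⟩
      ν (suc n) * ν⁻¹ n * C (suc n)    ≈⟨ solve 3 (λ a b c → a :* b :* c := a :* c :* b) refl _ _ _ ⟩
      D C n * ν⁻¹ n                    ≈⟨ *-congʳ (leibniz (e x) (e y) n) ⟩
      (conv (D (e x)) (e y) n + conv (e x) (D (e y)) n) * ν⁻¹ n
        ≈⟨ *-congʳ (+-cong (trans (conv-cong (D-e x) (λ _ → refl) n) (conv-*ˡ x (e x) (e y) n))
                           (trans (conv-cong (λ _ → refl) (D-e y) n) (conv-*ʳ y (e x) (e y) n))) ⟩
      (x * C n + y * C n) * ν⁻¹ n      ≈⟨ *-congʳ (sym (distribʳ _ _ _)) ⟩
      (x + y) * C n * ν⁻¹ n            ≈⟨ *-congʳ (*-congˡ (conv-e x y n)) ⟩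
      (x + y) * e (x + y) n * ν⁻¹ n    ∎
      where C = conv (e x) (e y)

    conv⁺-e : ∀ x y n → conv⁺ (e x) (∑ (e y)) n ≈ ∑ (e (x + y)) n
    conv⁺-e x y n = trans (conv⁺-∑ (e x) (e y) n) (∑-cong (conv-e x y) n)

-- The complex numbers: ring structure and bounds on the modulus.

module ComplexNorm {c ℓ₁ ℓ₂} (R : RealField c ℓ₁ ℓ₂) where
  module ℝ = RealLemmas R
  open Complex R public
  open ℤ-solver ℝ.ℝ-commutativeRing

  ℂ-commutativeRing : CommutativeRing c ℓ₁
  ℂ-commutativeRing = record
    { RawRing ℂ-rawRing
    ; isCommutativeRing = record
      { isRing = record
        { +-isAbelianGroup = record
          { isGroup = record
            { isMonoid = record
              { isSemigroup = record
                { isMagma = record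
                  { isEquivalence = record
                    { refl  = ℝ.refl , ℝ.refl
                    ; sym   = λ (p , q) → ℝ.sym p , ℝ.sym q
                    ; trans = λ (p , q) (p′ , q′) → ℝ.trans p p′ , ℝ.trans q q′
                    }
                  ; ∙-cong = λ (p , q) (p′ , q′) → ℝ.+-cong p p′ , ℝ.+-cong q q′
                  }
                ; assoc = λ _ _ _ → ℝ.+-assoc _ _ _ , ℝ.+-assoc _ _ _
                }
              ; identity = (λ _ → ℝ.+-identityˡ _ , ℝ.+-identityˡ _) , (λ _ → ℝ.+-identityʳ _ , ℝ.+-identityʳ _)
              }
            ; inverse = (λ _ → ℝ.-‿inverseˡ _ , ℝ.-‿inverseˡ _) , (λ _ → ℝ.-‿inverseʳ _ , ℝ.-‿inverseʳ _)
            ; ⁻¹-cong = λ (p , q) → ℝ.-‿cong p , ℝ.-‿cong q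
            }
          ; comm = λ _ _ → ℝ.+-comm _ _ , ℝ.+-comm _ _
          }
        ; *-cong = λ (p , q) (p′ , q′) →
            ℝ.+-cong (ℝ.*-cong p p′) (ℝ.-‿cong (ℝ.*-cong q q′)) , ℝ.+-cong (ℝ.*-cong p q′) (ℝ.*-cong q p′)
        ; *-assoc = λ _ _ _ →
            solve 6 (λ a b c d e f → (a :* c :- b :* d) :* e :- (a :* d :+ b :* c) :* f
                       := a :* (c :* e :- d :* f) :- b :* (c :* f :+ d :* e)) ℝ.refl _ _ _ _ _ _ ,
            solve 6 (λ a b c d e f → (a :* c :- b :* d) :* f :+ (a :* d :+ b :* c) :* e
                       := a :* (c :* f :+ d :* e) :+ b :* (c :* e :- d :* f)) ℝ.refl _ _ _ _ _ _
        ; *-identity =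
            (λ _ → solve 2 (λ a b → con (+ 1) :* a :- con (+ 0) :* b := a) ℝ.refl _ _ ,
                   solve 2 (λ a b → con (+ 1) :* b :+ con (+ 0) :* a := b) ℝ.refl _ _) ,
            (λ _ → solve 2 (λ a b → a :* con (+ 1) :- b :* con (+ 0) := a) ℝ.refl _ _ ,
                   solve 2 (λ a b → a :* con (+ 0) :+ b :* con (+ 1) := b) ℝ.refl _ _)
        ; distrib =
            (λ _ _ _ → solve 6 (λ a b c d e f → a :* (c :+ e) :- b :* (d :+ f) := a :* c :- b :* d :+ (a :* e :- b :* f)) ℝ.refl _ _ _ _ _ _ ,
                       solve 6 (λ a b c d e f → a :* (d :+ f) :+ b :* (c :+ e) := a :* d :+ b :* c :+ (a :* f :+ b :* e)) ℝ.refl _ _ _ _ _ _) ,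
            (λ _ _ _ → solve 6 (λ a b c d e f → (c :+ e) :* a :- (d :+ f) :* b := c :* a :- d :* b :+ (e :* a :- f :* b)) ℝ.refl _ _ _ _ _ _ ,
                       solve 6 (λ a b c d e f → (c :+ e) :* b :+ (d :+ f) :* a := c :* b :+ d :* a :+ (e :* b :+ f :* a)) ℝ.refl _ _ _ _ _ _)
        }
      ; *-comm = λ _ _ → solve 4 (λ a b c d → a :* c :- b :* d := c :* a :- d :* b) ℝ.refl _ _ _ _ ,
                         solve 4 (λ a b c d → a :* d :+ b :* c := c :* b :+ d :* a) ℝ.refl _ _ _ _
      }
    }

  open CommutativeRing ℂ-commutativeRing using (refl; sym; trans)

  ofReal-homo-* : ∀ a b → ofReal a * ofReal b ≈ ofReal (a ℝ.* b)
  ofReal-homo-* a b =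
    solve 2 (λ a b → a :* b :- con (+ 0) :* con (+ 0) := a :* b) ℝ.refl a b ,
    solve 2 (λ a b → a :* con (+ 0) :+ con (+ 0) :* b := con (+ 0)) ℝ.refl a b

  normSq-cong : ∀ {x y} → x ≈ y → normSq x ℝ.≈ normSq y
  normSq-cong (p , q) = ℝ.+-cong (ℝ.*-cong p p) (ℝ.*-cong q q)

  normSq-* : ∀ x y → normSq (x * y) ℝ.≈ normSq x ℝ.* normSq y
  normSq-* x y = solve 4 (λ a b c d → (a :* c :- b :* d) :* (a :* c :- b :* d) :+ (a :* d :+ b :* c) :* (a :* d :+ b :* c)
    := (a :* a :+ b :* b) :* (c :* c :+ d :* d)) ℝ.refl (re x) (im x) (re y) (im y)

  0≤normSq : ∀ x → ℝ.0# ℝ.≤ normSq x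
  0≤normSq x = ℝ.0≤x+y (ℝ.0≤x*x _) (ℝ.0≤x*x _)

  *-recipʳ : ∀ x x#0 → x * recip x x#0 ≈ 1#
  *-recipʳ x x#0 = ℝ.trans
      (solve 3 (λ a b r → a :* (a :* r :- :- b :* con (+ 0)) :- b :* (a :* con (+ 0) :+ :- b :* r) := (a :* a :+ b :* b) :* r) ℝ.refl (re x) (im x) r)
      (ℝ.*-recipʳ (normSq x) x#0) ,
    solve 3 (λ a b r → a :* (a :* con (+ 0) :+ :- b :* r) :+ b :* (a :* r :- :- b :* con (+ 0)) := con (+ 0)) ℝ.refl (re x) (im x) r
    where r = ℝ.recip (normSq x) x#0

  #0-cong : ∀ {x y} → x ≈ y → x #0 → y #0
  #0-cong x≈y = ℝ.#-congʳ (normSq-cong x≈y)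

  #0-* : ∀ {x y} → x #0 → y #0 → (x * y) #0
  #0-* {x} {y} x#0 y#0 = ℝ.#-congʳ (ℝ.sym (normSq-* x y)) (ℝ.x#0y#0→xy#0 x#0 y#0)

  #0-*ˡ : ∀ x y → (x * y) #0 → x #0
  #0-*ˡ x y xy#0 = ℝ.#0-*ˡ (ℝ.#-congʳ (normSq-* x y) xy#0)

  #0-*ʳ : ∀ x y → (x * y) #0 → y #0
  #0-*ʳ x y xy#0 = ℝ.#0-*ʳ (ℝ.#-congʳ (normSq-* x y) xy#0)

  re#0⇒#0 : ∀ z → re#0 z → z #0
  re#0⇒#0 z z#0 = ℝ.#-sym (ℝ.<⇒# (ℝ.<-≤-trans (ℝ.#0⇒0<square z#0)
    (ℝ.≤-by (im z ℝ.* im z) (ℝ.0≤x*x _) ℝ.refl)))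

  infix 4 ∣_∣≤_
  -- Bounds the modulus without forming it. The condition 0 ≤ a makes comparing squares the same as
  -- comparing the bounds.
  ∣_∣≤_ : ℂ → ℝ.Carrier → Set ℓ₂
  ∣ x ∣≤ a = (ℝ.0# ℝ.≤ a) × (normSq x ℝ.≤ a ℝ.* a)

  ∣∣≤-cong : ∀ {x y a} → x ≈ y → ∣ x ∣≤ a → ∣ y ∣≤ a
  ∣∣≤-cong x≈y (0≤a , x≤a) = 0≤a , ℝ.≤-trans (ℝ.≈⇒≤ (normSq-cong (sym x≈y))) x≤a

  ∣∣≤-mono : ∀ {x a b} → a ℝ.≤ b → ∣ x ∣≤ a → ∣ x ∣≤ b
  ∣∣≤-mono a≤b (0≤a , x≤a) = 0≤b , ℝ.≤-trans x≤a (ℝ.*-mono-≤ 0≤a 0≤b a≤b a≤b)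
    where 0≤b = ℝ.≤-trans 0≤a a≤b

  ∣∣≤-ofReal : ∀ {a} → ℝ.0# ℝ.≤ a → ∣ ofReal a ∣≤ a
  ∣∣≤-ofReal {a} 0≤a = 0≤a , ℝ.≈⇒≤ (solve 1 (λ a → a :* a :+ con (+ 0) :* con (+ 0) := a :* a) ℝ.refl a)

  ∣∣≤-neg : ∀ {x a} → ∣ x ∣≤ a → ∣ - x ∣≤ a
  ∣∣≤-neg {x} (0≤a , x≤a) = 0≤a , ℝ.≤-trans
    (ℝ.≈⇒≤ (solve 2 (λ a b → :- a :* :- a :+ :- b :* :- b := a :* a :+ b :* b) ℝ.refl (re x) (im x))) x≤a

  ∣∣≤-* : ∀ {x y a b} → ∣ x ∣≤ a → ∣ y ∣≤ b → ∣ x * y ∣≤ a ℝ.* b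
  ∣∣≤-* {x} {y} {a} {b} (0≤a , x≤a) (0≤b , y≤b) = ℝ.0≤x*y 0≤a 0≤b , (begin
    normSq (x * y)            ≈⟨ normSq-* x y ⟩
    normSq x ℝ.* normSq y      ≤⟨ ℝ.*-mono-≤ (0≤normSq x) (ℝ.0≤x*x b) x≤a y≤b ⟩
    a ℝ.* a ℝ.* (b ℝ.* b)      ≈⟨ solve 2 (λ a b → a :* a :* (b :* b) := a :* b :* (a :* b)) ℝ.refl a b ⟩
    a ℝ.* b ℝ.* (a ℝ.* b)      ∎)
    where open ℝ.≤-Reasoning

  -- Cauchy–Schwarz, from ⟨x, y⟩² + (re x im y - im x re y)² = |x|² |y|².
  inner-≤ : ∀ {x y a b} → ∣ x ∣≤ a → ∣ y ∣≤ b → re x ℝ.* re y ℝ.+ im x ℝ.* im y ℝ.≤ a ℝ.* b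
  inner-≤ {x} {y} {a} {b} x≤a@(0≤a , _) y≤b@(0≤b , _) = ℝ.square-cancel-≤ (ℝ.0≤x*y 0≤a 0≤b) (begin
    p ℝ.* p            ≤⟨ ℝ.≤-by (q ℝ.* q) (ℝ.0≤x*x q)
      (solve 4 (λ a b c d → (a :* c :- b :* d) :* (a :* c :- b :* d) :+ (a :* d :+ b :* c) :* (a :* d :+ b :* c)
         := (a :* c :+ b :* d) :* (a :* c :+ b :* d) :+ (a :* d :- b :* c) :* (a :* d :- b :* c)) ℝ.refl (re x) (im x) (re y) (im y)) ⟩
    normSq (x * y)     ≤⟨ proj₂ (∣∣≤-* {x} {y} x≤a y≤b) ⟩
    a ℝ.* b ℝ.* (a ℝ.* b) ∎)
    where
    open ℝ.≤-Reasoning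
    p = re x ℝ.* re y ℝ.+ im x ℝ.* im y
    q = re x ℝ.* im y ℝ.- im x ℝ.* re y

  -- Expanding the square of the sum leaves twice the inner product, which `inner-≤` bounds by a b.
  ∣∣≤-+ : ∀ {x y a b} → ∣ x ∣≤ a → ∣ y ∣≤ b → ∣ x + y ∣≤ a ℝ.+ b
  ∣∣≤-+ {x} {y} {a} {b} x≤a@(0≤a , xx≤aa) y≤b@(0≤b , yy≤bb) = ℝ.0≤x+y 0≤a 0≤b , (begin
    normSq (x + y)
      ≈⟨ solve 4 (λ a b c d → (a :+ c) :* (a :+ c) :+ (b :+ d) :* (b :+ d)
           := a :* a :+ b :* b :+ (c :* c :+ d :* d) :+ (a :* c :+ b :* d :+ (a :* c :+ b :* d))) ℝ.refl (re x) (im x) (re y) (im y) ⟩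
    normSq x ℝ.+ normSq y ℝ.+ (p ℝ.+ p)
      ≤⟨ ℝ.+-mono-≤ (ℝ.+-mono-≤ xx≤aa yy≤bb) (ℝ.+-mono-≤ p≤ab p≤ab) ⟩
    a ℝ.* a ℝ.+ b ℝ.* b ℝ.+ (a ℝ.* b ℝ.+ a ℝ.* b)
      ≈⟨ solve 2 (λ a b → a :* a :+ b :* b :+ (a :* b :+ a :* b) := (a :+ b) :* (a :+ b)) ℝ.refl a b ⟩
    (a ℝ.+ b) ℝ.* (a ℝ.+ b) ∎)
    where
    open ℝ.≤-Reasoning
    p = re x ℝ.* re y ℝ.+ im x ℝ.* im y
    p≤ab : p ℝ.≤ a ℝ.* b
    p≤ab = inner-≤ {x} {y} x≤a y≤b

  square-mono-abs : ∀ {x a} → x ℝ.≤ a → ℝ.- x ℝ.≤ a → x ℝ.* x ℝ.≤ a ℝ.* a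
  square-mono-abs {x} {a} x≤a -x≤a = ℝ.≤-by _ (ℝ.0≤x*y (ℝ.0≤y-x x≤a) (ℝ.0≤y-x -x≤a))
    (solve 2 (λ x a → a :* a := x :* x :+ (a :- x) :* (a :- :- x)) ℝ.refl x a)

  ∣∣≤-re+im : ∀ {x a b} → ℝ.0# ℝ.≤ a → ℝ.0# ℝ.≤ b →
    re x ℝ.≤ a → ℝ.- re x ℝ.≤ a → im x ℝ.≤ b → ℝ.- im x ℝ.≤ b → ∣ x ∣≤ a ℝ.+ b
  ∣∣≤-re+im {x} {a} {b} 0≤a 0≤b re≤a -re≤a im≤b -im≤b = ℝ.0≤x+y 0≤a 0≤b , (begin
    normSq x                  ≤⟨ ℝ.+-mono-≤ (square-mono-abs re≤a -re≤a) (square-mono-abs im≤b -im≤b) ⟩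
    a ℝ.* a ℝ.+ b ℝ.* b       ≤⟨ ℝ.≤-by _ (ℝ.0≤x+y 0≤ab 0≤ab)
                                  (solve 2 (λ a b → (a :+ b) :* (a :+ b) := a :* a :+ b :* b :+ (a :* b :+ a :* b)) ℝ.refl a b) ⟩
    (a ℝ.+ b) ℝ.* (a ℝ.+ b)   ∎)
    where
    open ℝ.≤-Reasoning
    0≤ab = ℝ.0≤x*y 0≤a 0≤b

  re-≤ : ∀ {x a} → ∣ x ∣≤ a → re x ℝ.≤ a
  re-≤ {x} (0≤a , x≤a) = ℝ.square-cancel-≤ 0≤a (ℝ.≤-trans (ℝ.≤-by (im x ℝ.* im x) (ℝ.0≤x*x _) ℝ.refl) x≤a)

  im-≤ : ∀ {x a} → ∣ x ∣≤ a → im x ℝ.≤ a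
  im-≤ {x} (0≤a , x≤a) = ℝ.square-cancel-≤ 0≤a (ℝ.≤-trans (ℝ.≤-by (re x ℝ.* re x) (ℝ.0≤x*x _) (ℝ.+-comm _ _)) x≤a)

  -- For t = |x|² ≥ 0 one has t ≤ (t + 1)², so t + 1 is a bound found without a root.
  bounded : ∀ x → ∃[ a ] ∣ x ∣≤ a
  bounded x = a , ℝ.0≤x+y (0≤normSq x) (ℝ.<⇒≤ ℝ.0<1) , ℝ.≤-by _ (ℝ.0≤x+y (ℝ.0≤x+y (ℝ.0≤x*x (normSq x)) (0≤normSq x)) (ℝ.<⇒≤ ℝ.0<1))
    (solve 1 (λ n → (n :+ con (+ 1)) :* (n :+ con (+ 1)) := n :+ (n :* n :+ n :+ con (+ 1))) ℝ.refl (normSq x))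
    where a = normSq x ℝ.+ ℝ.1#

  -- With no square roots for |x| itself, lower bounds on |x| are read off from re x.
  ∣recip∣≤ : ∀ {x b b′} x#0 → ℝ.0# ℝ.< b → b ℝ.≤ re x → ℝ.0# ℝ.≤ b′ → b ℝ.* b′ ℝ.≈ ℝ.1# → ∣ recip x x#0 ∣≤ b′
  ∣recip∣≤ {x} {b} {b′} x#0 0<b b≤re 0≤b′ bb′≈1 = 0≤b′ , ℝ.*-cancelˡ-≤ (b ℝ.* b) (ℝ.*-pos 0<b 0<b) (begin
    b ℝ.* b ℝ.* normSq y         ≤⟨ ℝ.*-mono-≤ (ℝ.0≤x*x b) (0≤normSq y) (ℝ.≤-trans
                                     (ℝ.*-mono-≤ (ℝ.<⇒≤ 0<b) (ℝ.≤-trans (ℝ.<⇒≤ 0<b) b≤re) b≤re b≤re)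
                                     (ℝ.≤-by (im x ℝ.* im x) (ℝ.0≤x*x _) ℝ.refl)) (ℝ.≈⇒≤ ℝ.refl) ⟩
    normSq x ℝ.* normSq y        ≈⟨ ℝ.sym (normSq-* x y) ⟩
    normSq (x * y)               ≈⟨ normSq-cong {x * y} {1#} (*-recipʳ x x#0) ⟩
    normSq 1#                    ≈⟨ solve 0 (con (+ 1) :* con (+ 1) :+ con (+ 0) :* con (+ 0) := con (+ 1) :* con (+ 1)) ℝ.refl ⟩
    ℝ.1# ℝ.* ℝ.1#                ≈⟨ ℝ.*-cong (ℝ.sym bb′≈1) (ℝ.sym bb′≈1) ⟩
    b ℝ.* b′ ℝ.* (b ℝ.* b′)      ≈⟨ solve 2 (λ b c → b :* c :* (b :* c) := b :* b :* (c :* c)) ℝ.refl b b′ ⟩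
    b ℝ.* b ℝ.* (b′ ℝ.* b′)      ∎)
    where
    open ℝ.≤-Reasoning
    y = recip x x#0

-- Limits of complex sequences.

module ComplexLimits {c ℓ₁ ℓ₂} (R : RealField c ℓ₁ ℓ₂) where
  open ComplexNorm R public
  open CommutativeRing ℂ-commutativeRing public
    using (refl; sym; trans; setoid; +-cong; +-congˡ; +-congʳ; +-identityˡ; -‿cong; -‿inverseʳ;
           *-cong; *-congˡ; *-congʳ; *-comm; *-assoc; *-identityˡ; *-identityʳ; distribˡ)
  open RingIdentities ℂ-commutativeRing
  module ℝ-identities = RingIdentities ℝ.ℝ-commutativeRing
  module ≈-Reasoning = SetoidReasoning setoid

  infix 4 _⟶_
  -- Equivalent to `Converges`, but with nonstrict bounds, which the triangle inequality adds up
  -- directly.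
  _⟶_ : (ℕ → ℂ) → ℂ → Set _
  s ⟶ L = ∀ ε → ℝ.0# ℝ.< ε → ∃[ N ] ∀ n → n ℕ.≥ N → ∣ s n - L ∣≤ ε

  ⟶⇒Converges : ∀ {s L} → s ⟶ L → Converges s L
  ⟶⇒Converges {s} {L} s⟶L ε 0<ε = let N , close = s⟶L (ℝ.half ε) (ℝ.half-pos 0<ε) in
    N , λ n n≥N →
    ℝ.≤-<-trans (proj₂ (close n n≥N)) (ℝ.square-mono-< (ℝ.<⇒≤ (ℝ.half-pos 0<ε)) (ℝ.half-< 0<ε))

  Converges⇒⟶ : ∀ {s L} → Converges s L → s ⟶ L
  Converges⇒⟶ s→L ε 0<ε = let N , close = s→L ε 0<ε in
    N , λ n n≥N → ℝ.<⇒≤ 0<ε , ℝ.<⇒≤ (close n n≥N)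

  ⟶-cong : ∀ {s t L M} → (∀ n → s n ≈ t n) → L ≈ M → s ⟶ L → t ⟶ M
  ⟶-cong {s} {t} {L} {M} s≈t L≈M s⟶L ε 0<ε = let N , close = s⟶L ε 0<ε in
    N , λ n n≥N → ∣∣≤-cong {s n - L} {t n - M} (+-cong (s≈t n) (-‿cong L≈M)) (close n n≥N)

  ⟶-const : ∀ L → (λ _ → L) ⟶ L
  ⟶-const L ε 0<ε = 0 , λ _ _ → ∣∣≤-mono {L - L} (ℝ.<⇒≤ 0<ε)
    (∣∣≤-cong {0#} {L - L} (sym (-‿inverseʳ L)) (∣∣≤-ofReal (ℝ.≈⇒≤ ℝ.refl)))

  ⟶-tail : ∀ {s L} → (s ∘ suc) ⟶ L → s ⟶ L
  ⟶-tail {s} {L} s⟶L ε 0<ε = let N , close = s⟶L ε 0<ε in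
    suc N , λ { (suc n) (s≤s n≥N) → close n n≥N }

  ⟶-+ : ∀ {s t L M} → s ⟶ L → t ⟶ M → (λ n → s n + t n) ⟶ L + M
  ⟶-+ {s} {t} {L} {M} s⟶L t⟶M ε 0<ε =
    let N₁ , close₁ = s⟶L (ℝ.half ε) (ℝ.half-pos 0<ε)
        N₂ , close₂ = t⟶M (ℝ.half ε) (ℝ.half-pos 0<ε)
    in N₁ ℕ.+ N₂ , λ n n≥N →
    ∣∣≤-mono {s n + t n - (L + M)} (ℝ.≈⇒≤ (ℝ.half+half ε))
      (∣∣≤-cong {s n - L + (t n - M)} {s n + t n - (L + M)}
        ([x-u]+[y-v] (s n) (t n) L M)
        (∣∣≤-+ {s n - L} {t n - M} (close₁ n (ℕ.m+n≤o⇒m≤o N₁ n≥N)) (close₂ n (ℕ.m+n≤o⇒n≤o N₁ n≥N))))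

  ⟶-* : ∀ {s t L M} → s ⟶ L → t ⟶ M → (λ n → s n * t n) ⟶ L * M
  ⟶-* {s} {t} {L} {M} s⟶L t⟶M ε 0<ε = go (bounded L) (bounded M)
    where
    go : ∃[ l ] ∣ L ∣≤ l → ∃[ m ] ∣ M ∣≤ m → ∃[ N ] ∀ n → n ℕ.≥ N → ∣ s n * t n - L * M ∣≤ ε
    go (l , L≤l) (m , M≤m) = combine (s⟶L δ 0<δ) (t⟶M δ 0<δ)
      where
      open ℝ.≤-Reasoning
      0≤ε = ℝ.<⇒≤ 0<ε
      -- The tolerance is δ = ε / C. The summand ε in `C` gives δ ≤ 1, and then the error δ (δ + l +
      -- m) ≤ δ (1 + l + m) ≤ δ C = ε.
      C = ε ℝ.+ (l ℝ.+ m) ℝ.+ ℝ.1#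
      ε+l+m≥0 : ℝ.0# ℝ.≤ ε ℝ.+ (l ℝ.+ m)
      ε+l+m≥0 = ℝ.0≤x+y 0≤ε (ℝ.0≤x+y (proj₁ L≤l) (proj₁ M≤m))
      0<C : ℝ.0# ℝ.< C
      0<C = ℝ.<-≤-trans ℝ.0<1 (ℝ.≤-by _ ε+l+m≥0 (ℝ.+-comm _ _))
      C#0 = ℝ.#-sym (ℝ.<⇒# 0<C)
      δ = ε ℝ.* ℝ.recip C C#0
      0<δ : ℝ.0# ℝ.< δ
      0<δ = ℝ.*-pos 0<ε (ℝ.recip-pos C#0 0<C)
      δC≈ε : δ ℝ.* C ℝ.≈ ε
      δC≈ε = ℝ.trans (ℝ.*-assoc _ _ _) (ℝ.trans (ℝ.*-congˡ (ℝ.trans (ℝ.*-comm _ _) (ℝ.*-recipʳ C C#0))) (ℝ.*-identityʳ ε))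
      δ≤1 : δ ℝ.≤ ℝ.1#
      δ≤1 = ℝ.*-cancelˡ-≤ C 0<C (begin
        C ℝ.* δ      ≈⟨ ℝ.trans (ℝ.*-comm _ _) δC≈ε ⟩
        ε            ≤⟨ ℝ.≤-by (l ℝ.+ m ℝ.+ ℝ.1#) (ℝ.0≤x+y (ℝ.0≤x+y (proj₁ L≤l) (proj₁ M≤m)) (ℝ.<⇒≤ ℝ.0<1)) (ℝ.+-assoc _ _ _) ⟩
        C            ≈⟨ ℝ.sym (ℝ.*-identityʳ C) ⟩
        C ℝ.* ℝ.1#   ∎)
      δδ+lδ+δm≤ε : δ ℝ.* δ ℝ.+ (l ℝ.* δ ℝ.+ δ ℝ.* m) ℝ.≤ ε
      δδ+lδ+δm≤ε = begin
        δ ℝ.* δ ℝ.+ (l ℝ.* δ ℝ.+ δ ℝ.* m)  ≈⟨ ℝ.+-congˡ (ℝ.trans (ℝ.+-congʳ (ℝ.*-comm l δ)) (ℝ.sym (ℝ.distribˡ δ l m))) ⟩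
        δ ℝ.* δ ℝ.+ δ ℝ.* (l ℝ.+ m)        ≈⟨ ℝ.sym (ℝ.distribˡ δ δ _) ⟩
        δ ℝ.* (δ ℝ.+ (l ℝ.+ m))            ≤⟨ ℝ.*-monoˡ-≤ δ (ℝ.<⇒≤ 0<δ) (ℝ.+-monoˡ-≤ _ δ≤1) ⟩
        δ ℝ.* (ℝ.1# ℝ.+ (l ℝ.+ m))         ≤⟨ ℝ.*-monoˡ-≤ δ (ℝ.<⇒≤ 0<δ) (ℝ.≤-by ε 0≤ε
                                              (ℝ.trans (ℝ.+-assoc _ _ _) (ℝ.trans (ℝ.+-comm _ _) (ℝ.+-congʳ (ℝ.+-comm _ _))))) ⟩
        δ ℝ.* C                            ≈⟨ δC≈ε ⟩
        ε                                  ∎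
      combine : ∃[ N ] (∀ n → n ℕ.≥ N → ∣ s n - L ∣≤ δ) → ∃[ N ] (∀ n → n ℕ.≥ N → ∣ t n - M ∣≤ δ) →
                ∃[ N ] ∀ n → n ℕ.≥ N → ∣ s n * t n - L * M ∣≤ ε
      combine (N₁ , close₁) (N₂ , close₂) = N₁ ℕ.+ N₂ , λ n n≥N →
        let s≤δ = close₁ n (ℕ.m+n≤o⇒m≤o N₁ n≥N)
            t≤δ = close₂ n (ℕ.m+n≤o⇒n≤o N₁ n≥N)
        in ∣∣≤-mono {s n * t n - L * M} δδ+lδ+δm≤ε
          (∣∣≤-cong {(s n - L) * (t n - M) + (L * (t n - M) + (s n - L) * M)} {s n * t n - L * M}
            (sub-* (s n) (t n) L M)
            (∣∣≤-+ {(s n - L) * (t n - M)} {L * (t n - M) + (s n - L) * M}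
              (∣∣≤-* {s n - L} {t n - M} s≤δ t≤δ)
              (∣∣≤-+ {L * (t n - M)} {(s n - L) * M}
                (∣∣≤-* {L} {t n - M} L≤l t≤δ) (∣∣≤-* {s n - L} {M} s≤δ M≤m))))

  ⟶-*ˡ : ∀ a {s L} → s ⟶ L → (λ n → a * s n) ⟶ a * L
  ⟶-*ˡ a {s} {L} s⟶L = ⟶-* {λ _ → a} {s} {a} {L} (⟶-const a) s⟶L

  ⟶-neg : ∀ {s L} → s ⟶ L → (λ n → - s n) ⟶ - L
  ⟶-neg {s} {L} s⟶L ε 0<ε = let N , close = s⟶L ε 0<ε in
    N , λ n n≥N → ∣∣≤-cong { - (s n - L)} { - s n - (- L)}
    (neg-sub (s n) L) (∣∣≤-neg {s n - L} (close n n≥N))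

  ⟶-dominated : ∀ {s r} → ℝ.Null r → (∀ n → ∣ s n ∣≤ r n) → s ⟶ 0#
  ⟶-dominated {s} {r} r-null s≤r ε 0<ε = let N , r<ε = r-null ε 0<ε in
    N , λ n n≥N → ∣∣≤-mono {s n - 0#} (ℝ.<⇒≤ (r<ε n n≥N))
    (∣∣≤-cong {s n} {s n - 0#} (x-0 (s n)) (s≤r n))

  ∣∣≤-all-ε : ∀ {x} → (∀ ε → ℝ.0# ℝ.< ε → ∣ x ∣≤ ε) → x ≈ 0#
  ∣∣≤-all-ε {x} x≤ε = part (λ ε 0<ε → re-≤ {x} (x≤ε ε 0<ε)) (λ ε 0<ε → re-≤ { - x} (∣∣≤-neg {x} (x≤ε ε 0<ε))) ,
                      part (λ ε 0<ε → im-≤ {x} (x≤ε ε 0<ε)) (λ ε 0<ε → im-≤ { - x} (∣∣≤-neg {x} (x≤ε ε 0<ε)))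
    where
    part : ∀ {a} → (∀ ε → ℝ.0# ℝ.< ε → a ℝ.≤ ε) → (∀ ε → ℝ.0# ℝ.< ε → ℝ.- a ℝ.≤ ε) → a ℝ.≈ ℝ.0#
    part a≤ε -a≤ε = ℝ.≤-antisym (ℝ.≤-of-all-ε a≤ε)
      (ℝ.≤-by _ (ℝ.0≤y-x (ℝ.≤-of-all-ε -a≤ε)) (ℝ-identities.0+[0--x] _))

  ⟶-unique : ∀ {s L M} → s ⟶ L → s ⟶ M → L ≈ M
  ⟶-unique {s} {L} {M} s⟶L s⟶M = begin
    L                 ≈⟨ sym (x-y+y L M) ⟩
    L - M + M         ≈⟨ +-congʳ (∣∣≤-all-ε {L - M} close) ⟩
    0# + M            ≈⟨ +-identityˡ M ⟩
    M                 ∎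
    where
    open ≈-Reasoning
    -- The differences s n - s n vanish yet tend to L - M, so L - M lies within every ε of 0.
    d⟶0 : (λ n → s n + - s n) ⟶ L + - M
    d⟶0 = ⟶-+ {s} {λ n → - s n} s⟶L (⟶-neg {s} s⟶M)
    close : ∀ ε → ℝ.0# ℝ.< ε → ∣ L - M ∣≤ ε
    close ε 0<ε = let N , d≤ε = d⟶0 ε 0<ε in
      ∣∣≤-cong { - (s N + - s N - (L - M))} {L - M}
      (-[x-x-[y-z]] (s N) L M)
      (∣∣≤-neg {s N + - s N - (L - M)} (d≤ε N ℕ.≤-refl))

  -- Past `K` the increments add up to at most r n - r (j + n) ≤ r n, which is small. So the real
  -- and imaginary parts are Cauchy, and completeness applies to each of them.
  ⟶-telescoping : ∀ s r K → ℝ.Null r → (∀ n → ℝ.0# ℝ.≤ r n) →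
    (∀ n → n ℕ.≥ K → ∣ s (suc n) - s n ∣≤ r n ℝ.- r (suc n)) → ∃[ L ] s ⟶ L
  ⟶-telescoping s r K r-null 0≤r step = L , s⟶L
    where
    drift : ∀ n → n ℕ.≥ K → ∀ j → ∣ s (j ℕ.+ n) - s n ∣≤ r n ℝ.- r (j ℕ.+ n)
    drift n n≥K zero    = ∣∣≤-mono {s n - s n} (ℝ.≈⇒≤ (ℝ.sym (ℝ.-‿inverseʳ (r n))))
      (∣∣≤-cong {0#} {s n - s n} (sym (-‿inverseʳ (s n))) (∣∣≤-ofReal (ℝ.≈⇒≤ ℝ.refl)))
    drift n n≥K (suc j) = ∣∣≤-mono {s (suc m) - s n} (ℝ.≈⇒≤ telescope)
      (∣∣≤-cong {s (suc m) - s m + (s m - s n)} {s (suc m) - s n}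
        ([x-y]+[y-z] (s (suc m)) (s m) (s n))
        (∣∣≤-+ {s (suc m) - s m} {s m - s n} (step m (ℕ.≤-trans n≥K (ℕ.m≤n+m n j))) (drift n n≥K j)))
      where
      m = j ℕ.+ n
      telescope : r m ℝ.- r (suc m) ℝ.+ (r n ℝ.- r m) ℝ.≈ r n ℝ.- r (suc m)
      telescope = ℝ.trans (ℝ.+-comm _ _) (ℝ-identities.[x-y]+[y-z] (r n) (r m) (r (suc m)))
    tail : ∀ ε → ℝ.0# ℝ.< ε → ∃[ N ] ∀ n → n ℕ.≥ N → ∣ s n - s N ∣≤ ε
    tail ε 0<ε = N , λ n n≥N → ≡.subst (λ k → ∣ s k - s N ∣≤ ε) (ℕ.m∸n+n≡m n≥N)
      (∣∣≤-mono {s (n ℕ.∸ N ℕ.+ N) - s N} (ℝ.≤-trans (ℝ.≤-by _ (0≤r _) (ℝ.sym (ℝ-identities.x-y+y _ _)))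
                                           (ℝ.<⇒≤ (proj₂ small N (ℕ.m≤m+n (proj₁ small) K))))
        (drift N (ℕ.m≤n+m K (proj₁ small)) (n ℕ.∸ N)))
      where
      small = r-null ε 0<ε
      N = proj₁ small ℕ.+ K
    cauchy : (f : ℂ → ℝ.Carrier) → (∀ x y → f (x - y) ℝ.≈ f x ℝ.- f y) → (∀ {x a} → ∣ x ∣≤ a → f x ℝ.≤ a) →
             ℝ.IsCauchy (f ∘ s)
    cauchy f f-sub f≤ ε 0<ε = N , λ m n m≥N n≥N → near m n m≥N n≥N , near n m n≥N m≥N
      where
      -- Two terms within ε / 4 of `s N` differ by at most ε / 2, which leaves room for the strict
      -- inequality in `Near`.
      cut = tail (ℝ.half (ℝ.half ε)) (ℝ.half-pos (ℝ.half-pos 0<ε))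
      N = proj₁ cut
      close : ∀ n → n ℕ.≥ N → ∣ s n - s N ∣≤ ℝ.half (ℝ.half ε)
      close = proj₂ cut
      near : ∀ m n → m ℕ.≥ N → n ℕ.≥ N → f (s m) ℝ.< f (s n) ℝ.+ ε
      near m n m≥N n≥N = begin-strict
        f (s m)                                ≈⟨ ℝ.sym (ℝ-identities.x-y+y _ _) ⟩
        f (s m) ℝ.- f (s n) ℝ.+ f (s n)        ≈⟨ ℝ.+-comm _ _ ⟩
        f (s n) ℝ.+ (f (s m) ℝ.- f (s n))      ≈⟨ ℝ.+-congˡ (ℝ.sym (f-sub (s m) (s n))) ⟩
        f (s n) ℝ.+ f (s m - s n)              ≤⟨ ℝ.+-mono-≤ (ℝ.≈⇒≤ ℝ.refl) (f≤ {s m - s n} (∣∣≤-cong {s m - s N + - (s n - s N)} {s m - s n}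
                                                    ([x-z]-[y-z] (s m) (s n) (s N))
                                                    (∣∣≤-+ {s m - s N} { - (s n - s N)} (close m m≥N) (∣∣≤-neg {s n - s N} (close n n≥N))))) ⟩
        f (s n) ℝ.+ (ℝ.half (ℝ.half ε) ℝ.+ ℝ.half (ℝ.half ε)) ≈⟨ ℝ.+-congˡ (ℝ.half+half _) ⟩
        f (s n) ℝ.+ ℝ.half ε                   ≈⟨ ℝ.+-comm _ _ ⟩
        ℝ.half ε ℝ.+ f (s n)                   <⟨ ℝ.+-monoˡ-< _ (ℝ.half-< 0<ε) ⟩
        ε ℝ.+ f (s n)                          ≈⟨ ℝ.+-comm _ _ ⟩
        f (s n) ℝ.+ ε                          ∎
        where open ℝ.≤-Reasoning
    re-limit = ℝ.complete (re ∘ s) (cauchy re (λ _ _ → ℝ.refl) (λ {x} → re-≤ {x}))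
    im-limit = ℝ.complete (im ∘ s) (cauchy im (λ _ _ → ℝ.refl) (λ {x} → im-≤ {x}))
    L = proj₁ re-limit +i proj₁ im-limit
    s⟶L : s ⟶ L
    s⟶L ε 0<ε =
      let N₁ , near₁ = proj₂ re-limit (ℝ.half ε) (ℝ.half-pos 0<ε)
          N₂ , near₂ = proj₂ im-limit (ℝ.half ε) (ℝ.half-pos 0<ε)
      in
      N₁ ℕ.+ N₂ , λ n n≥N →
      let re≤ = near₁ n (ℕ.m+n≤o⇒m≤o N₁ n≥N)
          im≤ = near₂ n (ℕ.m+n≤o⇒n≤o N₁ n≥N)
      in ∣∣≤-mono {s n - L} (ℝ.≈⇒≤ (ℝ.half+half ε))
        (∣∣≤-re+im {s n - L} 0≤h 0≤h (ℝ.sub-≤ (proj₁ re≤)) (ℝ.neg-sub-≤ (proj₂ re≤)) (ℝ.sub-≤ (proj₁ im≤)) (ℝ.neg-sub-≤ (proj₂ im≤)))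
      where 0≤h = ℝ.<⇒≤ (ℝ.half-pos 0<ε)

-- The real exponential series: the majorant of the defect and its decay.

module RealExponential {c ℓ₁ ℓ₂} (R : RealField c ℓ₁ ℓ₂) where
  open RealLemmas R
  open Sequences ℝ-commutativeRing public
  open Exponential fromℕ refl (λ _ → refl) (λ n → 1/ℕ (suc n)) (λ n → fromℕ-*-1/ℕ (suc n)) public
  open ℤ-solver ℝ-commutativeRing

  ∑-mono : ∀ {f} → (∀ j → 0# ≤ f j) → ∀ i n → ∑ f n ≤ ∑ f (i ℕ.+ n)
  ∑-mono 0≤f zero    n = ≈⇒≤ refl
  ∑-mono 0≤f (suc i) n = ≤-trans (∑-mono 0≤f i n) (≤-by _ (0≤f _) refl)

  0≤∑ : ∀ {f} → (∀ j → 0# ≤ f j) → ∀ n → 0# ≤ ∑ f n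
  0≤∑ 0≤f zero    = ≈⇒≤ refl
  0≤∑ 0≤f (suc n) = 0≤x+y (0≤∑ 0≤f n) (0≤f n)

  0≤conv⁺ : ∀ {f h} → (∀ j → 0# ≤ f j) → (∀ j → 0# ≤ h j) → ∀ n → 0# ≤ conv⁺ f h n
  0≤conv⁺ 0≤f 0≤h zero    = ≈⇒≤ refl
  0≤conv⁺ 0≤f 0≤h (suc n) = 0≤x+y (0≤x*y (0≤f 0) (0≤h (suc n))) (0≤conv⁺ (λ j → 0≤f (suc j)) 0≤h n)

  -- For j < m the convolution pairs f j with h (m + n - j), at least h n by monotonicity; its
  -- remaining terms are nonnegative.
  ∑-*-≤-conv⁺ : ∀ {f h} → (∀ j → 0# ≤ f j) → (∀ j → 0# ≤ h j) → (∀ i n → h n ≤ h (i ℕ.+ n)) →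
    ∀ m n → ∑ f m * h n ≤ conv⁺ f h (m ℕ.+ n)
  ∑-*-≤-conv⁺ 0≤f 0≤h h-mono zero    n = ≤-trans (≈⇒≤ (zeroˡ _)) (0≤conv⁺ 0≤f 0≤h n)
  ∑-*-≤-conv⁺ {f} {h} 0≤f 0≤h h-mono (suc m) n = begin
    ∑ f (suc m) * h n                                       ≈⟨ *-congʳ (∑-shift f m) ⟩
    (f 0 + ∑ (f ∘ suc) m) * h n                             ≈⟨ distribʳ _ _ _ ⟩
    f 0 * h n + ∑ (f ∘ suc) m * h n                         ≤⟨ +-mono-≤ (*-monoˡ-≤ (f 0) (0≤f 0) (h-mono (suc m) n))
                                                                (∑-*-≤-conv⁺ (λ j → 0≤f (suc j)) 0≤h h-mono m n) ⟩
    conv⁺ f h (suc m ℕ.+ n)                                 ∎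
    where open ≤-Reasoning

  0≤e : ∀ {x} → 0# ≤ x → ∀ n → 0# ≤ e x n
  0≤e 0≤x zero    = <⇒≤ 0<1
  0≤e 0≤x (suc n) = 0≤x*y (0≤x*y 0≤x (0≤e 0≤x n)) (<⇒≤ (1/ℕ-pos (suc n)))

  e-∑-defect : ∀ {x y} → 0# ≤ x → 0# ≤ y → ∀ n →
    ∑ (e x) n * ∑ (e y) n - conv⁺ (e x) (∑ (e y)) n ≤ ∑ (e (x + y)) (n ℕ.+ n) - ∑ (e (x + y)) n
  e-∑-defect {x} {y} 0≤x 0≤y n = begin
    ∑ (e x) n * ∑ (e y) n - conv⁺ (e x) (∑ (e y)) n
      ≤⟨ +-monoˡ-≤ _ (∑-*-≤-conv⁺ (0≤e 0≤x) (0≤∑ (0≤e 0≤y)) (∑-mono (0≤e 0≤y)) n n) ⟩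
    conv⁺ (e x) (∑ (e y)) (n ℕ.+ n) - conv⁺ (e x) (∑ (e y)) n
      ≈⟨ +-cong (conv⁺-e x y (n ℕ.+ n)) (-‿cong (conv⁺-e x y n)) ⟩
    ∑ (e (x + y)) (n ℕ.+ n) - ∑ (e (x + y)) n ∎
    where open ≤-Reasoning

  -- Consecutive terms have ratio x / (m + 1), at most 1 as soon as m ≥ K ≥ x.
  e-antitone : ∀ {x K} → 0# ≤ x → x ≤ fromℕ K → ∀ n → n ℕ.≥ K → ∀ j → e x (j ℕ.+ n) ≤ e x n
  e-antitone 0≤x x≤K n n≥K zero    = ≈⇒≤ refl
  e-antitone {x} {K} 0≤x x≤K n n≥K (suc j) = ≤-trans (*-cancelˡ-≤ (fromℕ (suc m)) (fromℕ-pos (suc m)) (begin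
    fromℕ (suc m) * e x (suc m)  ≈⟨ D-e x m ⟩
    x * e x m                    ≈⟨ *-comm _ _ ⟩
    e x m * x                    ≤⟨ *-monoˡ-≤ (e x m) (0≤e 0≤x m) (≤-trans x≤K (fromℕ-mono-≤ (ℕ.m≤n⇒m≤1+n (ℕ.≤-trans n≥K (ℕ.m≤n+m n j))))) ⟩
    e x m * fromℕ (suc m)        ≈⟨ *-comm _ _ ⟩
    fromℕ (suc m) * e x m        ∎)) (e-antitone 0≤x x≤K n n≥K j)
    where
    open ≤-Reasoning
    m = j ℕ.+ n

  ∑-tail-≤ : ∀ {f B} n → (∀ j → f (j ℕ.+ n) ≤ B) → ∀ j → ∑ f (j ℕ.+ n) - ∑ f n ≤ fromℕ j * B
  ∑-tail-≤ {f} {B} n f≤B zero    = ≈⇒≤ (trans (-‿inverseʳ _) (sym (zeroˡ B)))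
  ∑-tail-≤ {f} {B} n f≤B (suc j) = begin
    ∑ f (j ℕ.+ n) + f (j ℕ.+ n) - ∑ f n    ≈⟨ solve 3 (λ a b c → a :+ b :- c := b :+ (a :- c)) refl (∑ f (j ℕ.+ n)) (f (j ℕ.+ n)) (∑ f n) ⟩
    f (j ℕ.+ n) + (∑ f (j ℕ.+ n) - ∑ f n)  ≤⟨ +-mono-≤ (f≤B j) (∑-tail-≤ n f≤B j) ⟩
    B + fromℕ j * B                        ≈⟨ solve 2 (λ B j → B :+ j :* B := (con (+ 1) :+ j) :* B) refl B (fromℕ j) ⟩
    (1# + fromℕ j) * B                     ∎
    where open ≤-Reasoning

  -- n e_n = x e_{n-1} turns the crude bound n e_n on the block from n to 2n into
  -- a constant multiple of 1 / (n - 1).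
  e-∑-null : ∀ {x} → 0# ≤ x → Null (λ n → ∑ (e x) (n ℕ.+ n) - ∑ (e x) n)
  e-∑-null {x} 0≤x ε 0<ε = 2 ℕ.+ (N ℕ.+ K) , λ { (suc (suc n)) (s≤s (s≤s n≥N+K)) →
      ≤-<-trans (block n (ℕ.m+n≤o⇒n≤o N n≥N+K)) (small n (ℕ.m+n≤o⇒m≤o N n≥N+K)) }
    where
    open ≤-Reasoning
    K = proj₁ (archimedean x)
    x≤K = <⇒≤ (proj₂ (archimedean x))
    -- Applying the recurrence twice gives m (m - 1) eₘ = x² eₘ₋₂, at most `C` when m - 2 ≥ K.
    C = x * (x * e x K)
    N = proj₁ (C/n-null C ε 0<ε)
    small = proj₂ (C/n-null C ε 0<ε)
    block : ∀ n → n ℕ.≥ K → let m = 2 ℕ.+ n in ∑ (e x) (m ℕ.+ m) - ∑ (e x) m ≤ C * 1/ℕ (suc n)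
    block n n≥K = begin
      ∑ (e x) (m ℕ.+ m) - ∑ (e x) m       ≤⟨ ∑-tail-≤ m (e-antitone 0≤x x≤K m (ℕ.≤-trans n≥K (ℕ.m≤n+m n 2))) m ⟩
      fromℕ m * e x m                     ≈⟨ D-e x (suc n) ⟩
      x * e x (suc n)                     ≈⟨ *-congˡ (sym (*-identityˡ _)) ⟩
      x * (1# * e x (suc n))              ≈⟨ *-congˡ (*-congʳ (sym (fromℕ-*-1/ℕ (suc n)))) ⟩
      x * (ν * 1/ℕ (suc n) * e x (suc n)) ≈⟨ solve 4 (λ x a b c → x :* (a :* b :* c) := x :* (a :* c) :* b) refl x ν (1/ℕ (suc n)) (e x (suc n)) ⟩
      x * (ν * e x (suc n)) * 1/ℕ (suc n) ≈⟨ *-congʳ (*-congˡ (D-e x n)) ⟩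
      x * (x * e x n) * 1/ℕ (suc n)       ≈⟨ *-comm _ _ ⟩
      1/ℕ (suc n) * (x * (x * e x n))     ≤⟨ *-monoˡ-≤ _ (<⇒≤ (1/ℕ-pos (suc n))) (*-monoˡ-≤ x 0≤x (*-monoˡ-≤ x 0≤x
                                               (≡.subst (λ k → e x k ≤ e x K) (ℕ.m∸n+n≡m n≥K) (e-antitone 0≤x x≤K K ℕ.≤-refl (n ℕ.∸ K))))) ⟩
      1/ℕ (suc n) * C                     ≈⟨ *-comm _ _ ⟩
      C * 1/ℕ (suc n)                     ∎
      where
      m = 2 ℕ.+ n
      ν = fromℕ (suc n)

-- The addition theorem for the complex exponential, and powers of its values.

module ComplexExponential {c ℓ₁ ℓ₂} (R : RealField c ℓ₁ ℓ₂) where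
  open ComplexLimits R
  module ℝ-exp = RealExponential R
  open RingIdentities ℂ-commutativeRing
  open Sequences ℂ-commutativeRing
  open Exponential fromℕ refl (λ _ → ℝ.refl , ℝ.sym (ℝ.+-identityˡ _))
    (λ n → ofReal (ℝ.1/ℕ (suc n)))
    (λ n → trans (ofReal-homo-* _ _) (ℝ.fromℕ-*-1/ℕ (suc n) , ℝ.refl))

  ∑-dominated : ∀ {f F} → (∀ j → ∣ f j ∣≤ F j) → ∀ n i → ∣ ∑ f (i ℕ.+ n) - ∑ f n ∣≤ ℝ-exp.∑ F (i ℕ.+ n) ℝ.- ℝ-exp.∑ F n
  ∑-dominated {f} {F} f≤F n zero    = ∣∣≤-cong {0#} {∑ f n - ∑ f n} (sym (-‿inverseʳ (∑ f n)))
    (∣∣≤-mono {0#} (ℝ.≈⇒≤ (ℝ.sym (ℝ.-‿inverseʳ _))) (∣∣≤-ofReal (ℝ.≈⇒≤ ℝ.refl)))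
  ∑-dominated {f} {F} f≤F n (suc i) = ∣∣≤-cong {f m + (∑ f m - ∑ f n)} {∑ f (suc m) - ∑ f n} (x+[y-z] (f m) (∑ f m) (∑ f n))
    (∣∣≤-mono {f m + (∑ f m - ∑ f n)} (ℝ.≈⇒≤ (ℝ-identities.x+[y-z] _ _ _))
      (∣∣≤-+ {f m} {∑ f m - ∑ f n} (f≤F m) (∑-dominated {f} {F} f≤F n i)))
    where
    m = i ℕ.+ n

  -- By `conv⁺-defect` the defect is a sum of products of f j with the block of `g` from n - j to
  -- `M`, so the triangle inequality applies. `M` is separate from `n` because the induction
  -- shortens the sum of `f` only.
  defect-dominated : ∀ {f g F G} → (∀ j → ∣ f j ∣≤ F j) → (∀ j → ∣ g j ∣≤ G j) → ∀ M n → n ℕ.≤ M →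
    ∣ ∑ f n * ∑ g M - conv⁺ f (∑ g) n ∣≤ ℝ-exp.∑ F n ℝ.* ℝ-exp.∑ G M ℝ.- ℝ-exp.conv⁺ F (ℝ-exp.∑ G) n
  defect-dominated {f} {g} {F} {G} f≤F g≤G M zero n≤M =
    ∣∣≤-cong {0#} {0# * ∑ g M - 0#} (0≈0*x-0 (∑ g M))
      (∣∣≤-mono {0#} (ℝ.≈⇒≤ (ℝ-identities.0≈0*x-0 _)) (∣∣≤-ofReal (ℝ.≈⇒≤ ℝ.refl)))
  defect-dominated {f} {g} {F} {G} f≤F g≤G M (suc n) n<M =
    ∣∣≤-cong {f 0 * gap + rest} {∑ f (suc n) * ∑ g M - conv⁺ f (∑ g) (suc n)} (sym (conv⁺-defect f (∑ g) (∑ g M) n))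
      (∣∣≤-mono {f 0 * gap + rest} (ℝ.≈⇒≤ (ℝ.sym (ℝ-exp.conv⁺-defect F (ℝ-exp.∑ G) (ℝ-exp.∑ G M) n)))
        (∣∣≤-+ {f 0 * gap} {rest}
          (∣∣≤-* {f 0} {gap} (f≤F 0) gap≤)
          (defect-dominated {f ∘ suc} {g} {F ∘ suc} {G} (λ j → f≤F (suc j)) g≤G M n (ℕ.<⇒≤ n<M))))
    where
    gap rest : ℂ
    gap  = ∑ g M - ∑ g (suc n)
    rest = ∑ (f ∘ suc) n * ∑ g M - conv⁺ (f ∘ suc) (∑ g) n
    gap≤ : ∣ gap ∣≤ ℝ-exp.∑ G M ℝ.- ℝ-exp.∑ G (suc n)
    gap≤ = ≡.subst (λ k → ∣ ∑ g k - ∑ g (suc n) ∣≤ ℝ-exp.∑ G k ℝ.- ℝ-exp.∑ G (suc n)) (ℕ.m∸n+n≡m n<M)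
      (∑-dominated {g} {G} g≤G (suc n) (M ℕ.∸ suc n))

  e-dominated : ∀ {x X} → ∣ x ∣≤ X → ∀ n → ∣ e x n ∣≤ ℝ-exp.e X n
  e-dominated         x≤X zero    = ∣∣≤-ofReal (ℝ.<⇒≤ ℝ.0<1)
  e-dominated {x} {X} x≤X (suc n) = ∣∣≤-* {x * e x n} {ofReal (ℝ.1/ℕ (suc n))}
    (∣∣≤-* {x} {e x n} x≤X (e-dominated {x} {X} x≤X n)) (∣∣≤-ofReal (ℝ.<⇒≤ (ℝ.1/ℕ-pos (suc n))))

  e-⟶-+ : ∀ {x y A B} → ∑ (e x) ⟶ A → ∑ (e y) ⟶ B → ∑ (e (x + y)) ⟶ A * B
  -- The partial sums for x + y are written as the product of partial sums minus the null defect
  -- `d`.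
  e-⟶-+ {x} {y} {A} {B} x⟶A y⟶B = ⟶-cong {λ n → s n * t n + - d n} {∑ (e (x + y))} {A * B + - 0#} {A * B}
    (λ n → trans (x-[x-y] (s n * t n) (conv⁺ (e x) t n)) (conv⁺-e x y n)) (sym (x-0 (A * B)))
    (⟶-+ {λ n → s n * t n} {λ n → - d n} {A * B} { - 0#} (⟶-* {s} {t} x⟶A y⟶B) (⟶-neg {d} {0#} d⟶0))
    where
    s t d : ℕ → ℂ
    s = ∑ (e x)
    t = ∑ (e y)
    d n = s n * t n - conv⁺ (e x) t n
    d⟶0 : d ⟶ 0#
    d⟶0 = let X , x≤X = bounded x
              Y , y≤Y = bounded y
      in ⟶-dominated {d} (ℝ-exp.e-∑-null (ℝ.0≤x+y (proj₁ x≤X) (proj₁ y≤Y)))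
        (λ n → ∣∣≤-mono {d n} (ℝ-exp.e-∑-defect (proj₁ x≤X) (proj₁ y≤Y) n)
          (defect-dominated {e x} {e y} (e-dominated {x} x≤X) (e-dominated {y} y≤Y) n n ℕ.≤-refl))

  expTerm≈e : ∀ x n → expTerm x n ≈ e x n
  expTerm≈e x zero    = trans (*-identityˡ _) (ℝ.inverse-unique (ℝ.fromℕ-*-1/ℕ 1)
    (ℝ.trans (ℝ.*-congʳ (ℝ.+-identityʳ _)) (ℝ.*-identityˡ _)) , ℝ.refl)
  expTerm≈e x (suc n) = begin
    x * x ^ n * ofReal (1/[ suc n ]!)                              ≈⟨ *-congˡ (ℝ.1/ℕ-homo-* (suc n) (n !) {{_}} {{n ℕ.!≢0}} {{suc n ℕ.!≢0}} , ℝ.refl) ⟩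
    x * x ^ n * ofReal (ℝ.1/ℕ (suc n) ℝ.* 1/[ n ]!)                ≈⟨ *-congˡ (sym (ofReal-homo-* _ _)) ⟩
    x * x ^ n * (ofReal (ℝ.1/ℕ (suc n)) * ofReal 1/[ n ]!)         ≈⟨ rearrange x (x ^ n) _ _ ⟩
    x * (x ^ n * ofReal 1/[ n ]!) * ofReal (ℝ.1/ℕ (suc n))         ≈⟨ *-congʳ (*-congˡ (expTerm≈e x n)) ⟩
    x * e x n * ofReal (ℝ.1/ℕ (suc n))                             ∎
    where
    open ≈-Reasoning
    1/[_]! : ℕ → ℝ.Carrier
    1/[ n ]! = ℝ.1/ℕ (n !) {{n ℕ.!≢0}}
    rearrange : ∀ x y u v → x * y * (u * v) ≈ x * (y * v) * u
    rearrange = [xy][uv]≈[x[yv]]u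

  partialSum≈∑ : ∀ x n → partialSum (expTerm x) n ≈ ∑ (e x) n
  partialSum≈∑ x zero    = refl
  partialSum≈∑ x (suc n) = +-cong (partialSum≈∑ x n) (expTerm≈e x n)

  IsExp⇒⟶ : ∀ {x A} → IsExp x A → ∑ (e x) ⟶ A
  IsExp⇒⟶ {x} {A} h = ⟶-cong {partialSum (expTerm x)} {∑ (e x)} {A} (partialSum≈∑ x) refl (Converges⇒⟶ h)

  e-cong : ∀ {x y} → x ≈ y → ∀ n → e x n ≈ e y n
  e-cong x≈y zero    = refl
  e-cong x≈y (suc n) = *-congʳ (*-cong x≈y (e-cong x≈y n))

  -- Induction on the addition theorem; starting at 1 avoids computing exp 0.
  e-⟶-pow : ∀ k .{{_ : NonZero k}} {x A} → ∑ (e x) ⟶ A → ∑ (e (fromℕ k * x)) ⟶ A ^ k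
  e-⟶-pow 1 {x} {A} x⟶A = ⟶-cong {∑ (e x)} {∑ (e (fromℕ 1 * x))} {A} {A ^ 1}
    (∑-cong (e-cong {x} {fromℕ 1 * x} (sym (trans (*-congʳ (ℝ.+-identityʳ _ , ℝ.refl)) (*-identityˡ x)))))
    (sym (*-identityʳ A)) x⟶A
  e-⟶-pow (suc k@(suc _)) {x} {A} x⟶A = ⟶-cong {∑ (e (x + fromℕ k * x))} {∑ (e (fromℕ (suc k) * x))} {A ^ suc k}
    (∑-cong (e-cong {x + fromℕ k * x} {fromℕ (suc k) * x}
      (sym (trans (*-congʳ {x} {fromℕ (suc k)} {1# + fromℕ k} (ℝ.refl , ℝ.sym (ℝ.+-identityˡ _))) ([1+x]y (fromℕ k) x)))))
    refl (e-⟶-+ {x} {fromℕ k * x} x⟶A (e-⟶-pow k {x} {A} x⟶A))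

  -- Aʲ and Bᵏ are limits of the same series, that of exp (j x) = exp (k y). This is what turns a
  -- rational exponent into an algebraic equation.
  IsExp-pow : ∀ j k .{{_ : NonZero j}} .{{_ : NonZero k}} {x y A B} → IsExp x A → IsExp y B →
    fromℕ j * x ≈ fromℕ k * y → A ^ j ≈ B ^ k
  IsExp-pow j k {x} {y} {A} {B} expx expy jx≈ky = ⟶-unique {∑ (e (fromℕ j * x))}
    (e-⟶-pow j {x} {A} (IsExp⇒⟶ {x} expx))
    (⟶-cong {∑ (e (fromℕ k * y))} {∑ (e (fromℕ j * x))} {B ^ k}
      (∑-cong (e-cong {fromℕ k * y} {fromℕ j * x} (sym jx≈ky))) refl (e-⟶-pow k {y} {B} (IsExp⇒⟶ {y} expy)))

-- The series φₙ, its two factors and the recursion.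

module Series {ℓ₀ ℓ₁ ℓ₂} (R : RealField ℓ₀ ℓ₁ ℓ₂) where
  open ComplexLimits R
  open ComplexExponential R using (IsExp-pow)
  open RingIdentities ℂ-commutativeRing
  open CommutativeRing ℂ-commutativeRing using (semiring; commutativeSemiring)
  open import Algebra.Properties.Semiring.Exp semiring using (^-congˡ; ^-congʳ; ^-homo-*; ^-assocʳ)
  open import Algebra.Properties.CommutativeSemiring.Exp commutativeSemiring using (^-distrib-*)

  fromℕ-^ : ∀ a n → fromℕ a ^ n ≈ fromℕ (a ℕ.^ n)
  fromℕ-^ a zero    = ℝ.sym (ℝ.+-identityʳ _) , ℝ.refl
  fromℕ-^ a (suc n) = begin
    fromℕ a * fromℕ a ^ n                            ≈⟨ *-congˡ (fromℕ-^ a n) ⟩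
    fromℕ a * fromℕ (a ℕ.^ n)                        ≈⟨ ofReal-homo-* _ _ ⟩
    ofReal (ℝ.fromℕ a ℝ.* ℝ.fromℕ (a ℕ.^ n))         ≈⟨ (ℝ.sym (ℝ.fromℕ-homo-* a (a ℕ.^ n)) , ℝ.refl) ⟩
    fromℕ (a ℕ.* a ℕ.^ n)                            ∎
    where open ≈-Reasoning

  -‿^-even : ∀ x m → (- x) ^ (2 ℕ.^ suc m) ≈ x ^ (2 ℕ.^ suc m)
  -‿^-even x m = begin
    (- x) ^ (2 ℕ.* 2 ℕ.^ m)     ≈⟨ sym (^-assocʳ (- x) 2 (2 ℕ.^ m)) ⟩
    ((- x) ^ 2) ^ (2 ℕ.^ m)     ≈⟨ ^-congˡ (2 ℕ.^ m) (-‿square x) ⟩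
    (x ^ 2) ^ (2 ℕ.^ m)         ≈⟨ ^-assocʳ x 2 (2 ℕ.^ m) ⟩
    x ^ (2 ℕ.* 2 ℕ.^ m)         ∎
    where open ≈-Reasoning

  ^-double : ∀ x m → x ^ (2 ℕ.^ suc m) ≈ x ^ (2 ℕ.^ m) * x ^ (2 ℕ.^ m)
  ^-double x m = trans (^-homo-* x (2 ℕ.^ m) (2 ℕ.^ m ℕ.+ 0)) (*-congˡ (^-congʳ x (ℕ.+-identityʳ (2 ℕ.^ m))))

  ^-#0 : ∀ {z} → z #0 → ∀ n → (z ^ n) #0
  ^-#0     z#0 zero    = re#0⇒#0 1# (ℝ.#-sym (ℝ.<⇒# ℝ.0<1))
  ^-#0 {z} z#0 (suc n) = #0-* {z} z#0 (^-#0 {z} z#0 n)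

  recip-cong : ∀ {x y} x#0 y#0 → x ≈ y → recip x x#0 ≈ recip y y#0
  recip-cong {x} {y} x#0 y#0 x≈y = inverse-unique {x} (*-recipʳ x x#0) (trans (*-congʳ x≈y) (*-recipʳ y y#0))

  symmetricSum-* : ∀ a t n → a * symmetricSum t n ≈ symmetricSum (λ k → a * t k) n
  symmetricSum-* a t zero    = refl
  symmetricSum-* a t (suc n) = begin
    a * (symmetricSum t n + (t (+ suc n) + t -[1+ n ]))             ≈⟨ sym (distrib₃ a _ _ _) ⟩
    a * symmetricSum t n + a * (t (+ suc n) + t -[1+ n ])           ≈⟨ +-cong (symmetricSum-* a t n) (distribˡ a _ _) ⟩
    symmetricSum (λ k → a * t k) n + (a * t (+ suc n) + a * t -[1+ n ]) ∎
    where open ≈-Reasoning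

  symmetricSum-sub : ∀ t u n → symmetricSum (λ k → t k - u k) n ≈ symmetricSum t n - symmetricSum u n
  symmetricSum-sub t u zero    = refl
  symmetricSum-sub t u (suc n) = trans (+-congʳ (symmetricSum-sub t u n)) (interchange-sub _ _ _ _ _ _)

  symmetricSum-cong : ∀ {t u} → (∀ k → t k ≈ u k) → ∀ n → symmetricSum t n ≈ symmetricSum u n
  symmetricSum-cong t≈u zero    = t≈u (+ 0)
  symmetricSum-cong t≈u (suc n) = +-cong (symmetricSum-cong t≈u n) (+-cong (t≈u (+ suc n)) (t≈u -[1+ n ]))

  1/ℕ-telescope : ∀ m .{{_ : NonZero m}} → ℝ.1/ℕ m ℝ.* ℝ.1/ℕ (suc m) ℝ.≈ ℝ.1/ℕ m ℝ.- ℝ.1/ℕ (suc m)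
  1/ℕ-telescope m = ℝ-identities.inverse-difference (ℝ.fromℕ-*-1/ℕ m) (ℝ.fromℕ-*-1/ℕ (suc m))

  module _ (m : ℕ) (u : ℂ) (pole-free : ∀ k → (fromℤ k ^ (2 ℕ.^ suc m) + u) #0) where

    -- `u` takes the place of the power of z; only its real part enters the estimates.
    term : ℤ → ℂ
    term k = recip (fromℤ k ^ (2 ℕ.^ suc m) + u) (pole-free k)

    -- ∣ k ^ (2 ^ (m + 1)) + u ∣ ≥ k (k - 1) once k ≥ - re u.
    term-≤ : ∀ k n → fromℤ k ^ (2 ℕ.^ suc m) ≈ fromℕ (2 ℕ.+ n) ^ (2 ℕ.^ suc m) → ℝ.- re u ℝ.≤ ℝ.fromℕ n →
      ∣ term k ∣≤ ℝ.1/ℕ (suc n) ℝ.* ℝ.1/ℕ (2 ℕ.+ n)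
    term-≤ k n kᴺ≈aᴺ -re≤n = ∣recip∣≤ {fromℤ k ^ M + u} (pole-free k) (ℝ.*-pos (ℝ.fromℕ-pos (suc n)) (ℝ.fromℕ-pos a)) (begin
        ℝ.fromℕ (suc n) ℝ.* ℝ.fromℕ a               ≈⟨ ℝ.*-comm _ _ ⟩
        ℝ.fromℕ a ℝ.* ℝ.fromℕ (suc n)               ≤⟨ ℝ.≤-by _ (ℝ.0≤y-x (ℝ.neg-≤ (ℝ.≤-trans -re≤n (ℝ.fromℕ-mono-≤ (ℕ.m≤n+m n 2)))))
                                                         (ℝ-identities.square-shift _ _) ⟩
        ℝ.fromℕ a ℝ.* ℝ.fromℕ a ℝ.+ re u            ≤⟨ ℝ.+-monoˡ-≤ _ aa≤aᴺ ⟩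
        ℝ.fromℕ (a ℕ.^ M) ℝ.+ re u                  ≈⟨ ℝ.+-congʳ (ℝ.sym (proj₁ (trans kᴺ≈aᴺ (fromℕ-^ a M)))) ⟩
        re (fromℤ k ^ M + u)                        ∎)
      (ℝ.0≤x*y (ℝ.<⇒≤ (ℝ.1/ℕ-pos (suc n))) (ℝ.<⇒≤ (ℝ.1/ℕ-pos a)))
      (ℝ-identities.inverse-* (ℝ.fromℕ-*-1/ℕ (suc n)) (ℝ.fromℕ-*-1/ℕ a))
      where
      open ℝ.≤-Reasoning
      a = 2 ℕ.+ n
      M = 2 ℕ.^ suc m
      aa≤aᴺ : ℝ.fromℕ a ℝ.* ℝ.fromℕ a ℝ.≤ ℝ.fromℕ (a ℕ.^ M)
      aa≤aᴺ = ℝ.≤-trans (ℝ.≈⇒≤ (ℝ.sym (ℝ.fromℕ-homo-* a a))) (ℝ.fromℕ-mono-≤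
        (ℕ.≤-trans (ℕ.≤-reflexive (≡.cong (a ℕ.*_) (≡.sym (ℕ.*-identityʳ a))))
                   (ℕ.^-monoʳ-≤ a {2} {M} (ℕ.^-monoʳ-≤ 2 {1} {suc m} (s≤s z≤n)))))

    symmetricSum-converges : ∃[ S ] symmetricSum term ⟶ S
    symmetricSum-converges =
      -- Each of the two terms at ± (n + 2) is at most 1 / (n + 1) - 1 / (n + 2), whence the factor
      -- 2 in `r`. The bound 1 / k (k - 1) starts at k = 2, so the sequence is taken from index 1
      -- on.
      let S , s⟶S = ⟶-telescoping (s ∘ suc) r U (ℝ.C/n-null two) (λ n → ℝ.0≤x*y 0≤two (ℝ.<⇒≤ (ℝ.1/ℕ-pos (suc n)))) increment
      in S , ⟶-tail {s} s⟶S
      where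
      two = ℝ.1# ℝ.+ ℝ.1#
      0≤two : ℝ.0# ℝ.≤ two
      0≤two = ℝ.0≤x+y (ℝ.<⇒≤ ℝ.0<1) (ℝ.<⇒≤ ℝ.0<1)
      s = symmetricSum term
      r : ℕ → ℝ.Carrier
      r n = two ℝ.* ℝ.1/ℕ (suc n)
      U = proj₁ (ℝ.archimedean (ℝ.- re u))
      increment : ∀ n → n ℕ.≥ U → ∣ s (2 ℕ.+ n) - s (suc n) ∣≤ r n ℝ.- r (suc n)
      increment n n≥U = ∣∣≤-cong {term (+ (2 ℕ.+ n)) + term -[1+ suc n ]} {s (2 ℕ.+ n) - s (suc n)} (sym ([x+y]-x _ _))
        (∣∣≤-mono {term (+ (2 ℕ.+ n)) + term -[1+ suc n ]}
          (ℝ.≈⇒≤ (ℝ.trans (ℝ.+-cong (1/ℕ-telescope (suc n)) (1/ℕ-telescope (suc n))) (ℝ-identities.double-sub _ _)))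
          (∣∣≤-+ {term (+ (2 ℕ.+ n))} {term -[1+ suc n ]}
            (term-≤ (+ (2 ℕ.+ n)) n refl -re≤n)
            (term-≤ -[1+ suc n ] n (-‿^-even (fromℕ (2 ℕ.+ n)) m) -re≤n)))
        where
        -re≤n : ℝ.- re u ℝ.≤ ℝ.fromℕ n
        -re≤n = ℝ.≤-trans (ℝ.<⇒≤ (proj₂ (ℝ.archimedean (ℝ.- re u)))) (ℝ.fromℕ-mono-≤ n≥U)

  -- The factorisation k ^ 2N + z ^ 2N = (k ^ N + y ^ N) (k ^ N + v), where
  -- N = 2 ^ m and v = ± i z ^ N.
  module Factor (m : ℕ) (z y v : ℂ) (yᴺ≈-v : y ^ (2 ℕ.^ m) ≈ - v)
    (vv≈-ww : v * v ≈ - (z ^ (2 ℕ.^ m) * z ^ (2 ℕ.^ m))) (pole-free : PoleFree (suc m) z) where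

    κ : ℤ → ℂ
    κ k = fromℤ k ^ (2 ℕ.^ m)

    factorisation : ∀ k → φ-denominator m y k * (κ k + v) ≈ φ-denominator (suc m) z k
    factorisation k = trans (conjugate-factors (κ k) yᴺ≈-v vv≈-ww)
      (sym (+-cong (^-double (fromℤ k) m) (^-double z m)))

    factor-pole-free : PoleFree m y
    factor-pole-free k = #0-*ˡ (φ-denominator m y k) (κ k + v)
      (#0-cong {φ-denominator (suc m) z k} {φ-denominator m y k * (κ k + v)} (sym (factorisation k)) (pole-free k))

    t s : ℤ → ℂ
    t k = recip (φ-denominator m y k) (factor-pole-free k)
    s k = recip (φ-denominator (suc m) z k) (pole-free k)

    t≈[κ+v]s : ∀ k → t k ≈ (κ k + v) * s k
    t≈[κ+v]s k = inverse-of-factor (factorisation k)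
      (*-recipʳ (φ-denominator m y k) (factor-pole-free k)) (*-recipʳ (φ-denominator (suc m) z k) (pole-free k))

  φ-converges : ∀ n z (pole-free : PoleFree (suc n) z) → ∃[ S ] symmetricSum (λ k → recip (φ-denominator (suc n) z k) (pole-free k)) ⟶ S
  φ-converges n z pole-free = symmetricSum-converges n (z ^ (2 ℕ.^ suc n)) pole-free

  -- For m = 0 the terms 1 / (k + y) are only summable in the pairs ± k, where
  -- the part of (k + v) / (k² + z²) that is odd in k cancels.
  factor-converges : ∀ m z y v yᴺ≈-v vv≈-ww pole-free →
    let open Factor m z y v yᴺ≈-v vv≈-ww pole-free in ∃[ A ] symmetricSum t ⟶ A
  factor-converges zero z y v y≈-v vv≈-ww pole-free =
    let S , s⟶S = φ-converges 0 z pole-free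
    in v * S , ⟶-cong {λ n → v * symmetricSum s n} {symmetricSum t} {v * S}
      (λ n → sym (pairing n)) refl (⟶-*ˡ v {symmetricSum s} s⟶S)
    where
    open Factor zero z y v y≈-v vv≈-ww pole-free
    κ-odd : ∀ n → κ -[1+ n ] ≈ - κ (+ suc n)
    κ-odd n = trans (*-identityʳ _) (-‿cong (sym (*-identityʳ _)))
    s-even : ∀ n → s -[1+ n ] ≈ s (+ suc n)
    s-even n = recip-cong {φ-denominator 1 z -[1+ n ]} {φ-denominator 1 z (+ suc n)}
      (pole-free -[1+ n ]) (pole-free (+ suc n)) (+-congʳ (-‿^-even (fromℕ (suc n)) 0))
    pairing : ∀ n → symmetricSum t n ≈ v * symmetricSum s n
    -- The index 0 has no partner, but there κ vanishes and only the even part v remains.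
    pairing zero    = trans (t≈[κ+v]s (+ 0)) (*-congʳ (trans (+-congʳ (*-identityʳ _)) (+-identityˡ v)))
    pairing (suc n) = begin
      symmetricSum t n + (t (+ suc n) + t -[1+ n ])
        ≈⟨ +-cong (pairing n) (+-cong (t≈[κ+v]s (+ suc n)) (t≈[κ+v]s -[1+ n ])) ⟩
      v * symmetricSum s n + ((κ (+ suc n) + v) * s (+ suc n) + (κ -[1+ n ] + v) * s -[1+ n ])
        ≈⟨ +-congˡ (conjugate-pair v (κ-odd n) (s-even n)) ⟩
      v * symmetricSum s n + v * (s (+ suc n) + s -[1+ n ])
        ≈⟨ distrib₃ v _ _ _ ⟩
      v * symmetricSum s (suc n) ∎
      where open ≈-Reasoning
  -- Here the exponent of k is at least 2 and even, so the series in `y` converges by the general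
  -- comparison.
  factor-converges (suc m) z y v yᴺ≈-v vv≈-ww pole-free = φ-converges m y factor-pole-free
    where open Factor (suc m) z y v yᴺ≈-v vv≈-ww pole-free

  i*i≈-1 : i * i ≈ - 1#
  i*i≈-1 = ℝ-identities.0*0-1*1 , ℝ-identities.0*1+1*0

  i#0 : i #0
  i#0 = #0-*ˡ i i (#0-cong { - 1#} {i * i} (sym i*i≈-1) (re#0⇒#0 (- 1#) -1#0))
    where
    -1#0 : (ℝ.- ℝ.1#) ℝ.# ℝ.0#
    -1#0 = ℝ.<⇒# (ℝ.<-by ℝ.1# ℝ.0<1 (ℝ.sym (ℝ.-‿inverseˡ ℝ.1#)))

  -- With ℓ the logarithm of i and N = 2ᵐ, the equation N a = j gives N (a ℓ) = j ℓ; exponentiating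
  -- yields ωᴺ = iʲ.
  IsPow-root : ∀ m j .{{_ : NonZero j}} {a ω} → fromℕ (2 ℕ.^ m) * a ≈ fromℕ j → IsPow i a ω → ω ^ (2 ℕ.^ m) ≈ i ^ j
  IsPow-root m j {a} {ω} Na≈j (ℓ , (exp-ℓ , _) , exp-aℓ) =
    IsExp-pow (2 ℕ.^ m) j {{ℕ.m^n≢0 2 m}} {a * ℓ} {ℓ} {ω} {i} exp-aℓ exp-ℓ
      (trans (sym (*-assoc (fromℕ (2 ℕ.^ m)) a ℓ)) (*-congʳ Na≈j))

  2^-inverse : ∀ m → fromℕ (2 ℕ.^ m) * 2^- m ≈ 1#
  2^-inverse m = trans (ofReal-homo-* _ _) (ℝ.fromℕ-*-1/ℕ (2 ℕ.^ m) {{ℕ.m^n≢0 2 m}} , ℝ.refl)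

  φ-recursion : ∀ m (z : ℂ) → re#0 z → PoleFree (suc m) z → ∀ ω₁ ω₃ →
    IsPow i (2^- m) ω₁ → IsPow i (fromℕ 3 * 2^- m) ω₃ →
    ∃[ S ] ∃[ A ] ∃[ B ]
      Isφ (suc m) z S × Isφ m (ω₃ * z) A × Isφ m (ω₁ * z) B ×
      (Σ[ p ∈ (fromℕ 2 * i * z ^ (2 ℕ.^ m)) #0 ] S ≈ (A - B) * recip (fromℕ 2 * i * z ^ (2 ℕ.^ m)) p)
  φ-recursion m z re≢0 pole-free ω₁ ω₃ pow₁ pow₃ =
    let S , s⟶S = φ-converges m z pole-free
        A , a⟶A = factor-converges m z (ω₃ * z) v ω₃z (square-of-root i*i≈-1 w) pole-free
        B , b⟶B = factor-converges m z (ω₁ * z) (- v) ω₁z (trans (-x*-x v) (square-of-root i*i≈-1 w)) pole-free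
    in S , A , B , (pole-free , ⟶⇒Converges {symmetricSum A′.s} s⟶S) ,
       (A′.factor-pole-free , ⟶⇒Converges {symmetricSum A′.t} a⟶A) ,
       (B′.factor-pole-free , ⟶⇒Converges {symmetricSum B′.t} b⟶B) ,
       c#0 , quotient (A-B S A B s⟶S a⟶A b⟶B) (*-recipʳ c c#0)
    where
    w v c : ℂ
    w = z ^ (2 ℕ.^ m)
    v = i * w
    c = fromℕ 2 * i * w
    c#0 : c #0
    c#0 = #0-* {fromℕ 2 * i} {w} (#0-* {fromℕ 2} {i} (re#0⇒#0 (fromℕ 2) (ℝ.#-sym (ℝ.<⇒# (ℝ.fromℕ-pos 2)))) i#0)
      (^-#0 {z} (re#0⇒#0 z re≢0) (2 ℕ.^ m))
    ω₃z : (ω₃ * z) ^ (2 ℕ.^ m) ≈ - v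
    ω₃z = begin
      (ω₃ * z) ^ (2 ℕ.^ m)   ≈⟨ ^-distrib-* ω₃ z (2 ℕ.^ m) ⟩
      ω₃ ^ (2 ℕ.^ m) * w     ≈⟨ *-congʳ (IsPow-root m 3 {fromℕ 3 * 2^- m} {ω₃}
                                  (inverse-*-cancel (fromℕ 3) (2^-inverse m)) pow₃) ⟩
      i ^ 3 * w              ≈⟨ *-congʳ (cube i*i≈-1) ⟩
      - i * w                ≈⟨ sym (-‿distribˡ-* i w) ⟩
      - v                    ∎
      where open ≈-Reasoning
    ω₁z : (ω₁ * z) ^ (2 ℕ.^ m) ≈ - - v
    ω₁z = begin
      (ω₁ * z) ^ (2 ℕ.^ m)   ≈⟨ ^-distrib-* ω₁ z (2 ℕ.^ m) ⟩
      ω₁ ^ (2 ℕ.^ m) * w     ≈⟨ *-congʳ (IsPow-root m 1 {2^- m} {ω₁}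
                                  (trans (2^-inverse m) (ℝ.sym (ℝ.+-identityʳ _) , ℝ.refl)) pow₁) ⟩
      i ^ 1 * w              ≈⟨ *-congʳ (*-identityʳ i) ⟩
      v                      ≈⟨ sym (-‿involutive v) ⟩
      - - v                  ∎
      where open ≈-Reasoning
    -- Since (ω₃z)ᴺ = - v and (ω₁z)ᴺ = v, the cofactors are kᴺ + v and kᴺ - v. Both instances have
    -- the same `κ` and `s`, so their terms differ by 2v times `s`.
    module A′ = Factor m z (ω₃ * z) v ω₃z (square-of-root i*i≈-1 w) pole-free
    module B′ = Factor m z (ω₁ * z) (- v) ω₁z (trans (-x*-x v) (square-of-root i*i≈-1 w)) pole-free
    difference : ∀ k → A′.t k - B′.t k ≈ c * A′.s k
    difference k = begin
      A′.t k - B′.t k                                          ≈⟨ +-cong (A′.t≈[κ+v]s k) (-‿cong (B′.t≈[κ+v]s k)) ⟩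
      (A′.κ k + v) * A′.s k - (A′.κ k + - v) * A′.s k          ≈⟨ conjugate-difference (A′.κ k) v (A′.s k) ⟩
      (1# + 1#) * v * A′.s k                                   ≈⟨ *-congʳ (*-congʳ {v} {1# + 1#} {fromℕ 2}
                                                                  (ℝ.+-congˡ (ℝ.sym (ℝ.+-identityʳ _)) , ℝ.+-identityʳ _)) ⟩
      fromℕ 2 * v * A′.s k                                     ≈⟨ *-congʳ (sym (*-assoc (fromℕ 2) i w)) ⟩
      c * A′.s k                                               ∎
      where open ≈-Reasoning
    -- A single sequence of symmetric sums has the limits A - B and c S, so the two agree by
    -- uniqueness.
    A-B : ∀ S A B → symmetricSum A′.s ⟶ S → symmetricSum A′.t ⟶ A → symmetricSum B′.t ⟶ B → A - B ≈ c * S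
    A-B S A B s⟶S a⟶A b⟶B = ⟶-unique {λ n → c * symmetricSum A′.s n}
      (⟶-cong {λ n → symmetricSum A′.t n + - symmetricSum B′.t n} {λ n → c * symmetricSum A′.s n} {A - B}
        (λ n → trans (sym (symmetricSum-sub A′.t B′.t n)) (trans (symmetricSum-cong difference n) (sym (symmetricSum-* c A′.s n))))
        refl (⟶-+ {symmetricSum A′.t} {λ n → - symmetricSum B′.t n} a⟶A (⟶-neg {symmetricSum B′.t} b⟶B)))
      (⟶-*ˡ c {symmetricSum A′.s} s⟶S)

theorem2p6 : ∀ {c ℓ₁ ℓ₂} (R : RealField c ℓ₁ ℓ₂) → let open Complex R in
    (n : ℕ) .{{_ : NonZero n}} (z : ℂ) → re#0 z → PoleFree n z →
    (ω₁ ω₃ : ℂ) →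
    IsPow i (2^- pred n) ω₁ →
    IsPow i (fromℕ 3 * (2^- pred n)) ω₃ →
    ∃[ S ] ∃[ A ] ∃[ B ]
    Isφ n z S × Isφ (pred n) (ω₃ * z) A × Isφ (pred n) (ω₁ * z) B ×
    (Σ[ p ∈ (fromℕ 2 * i * z ^ (2 ℕ.^ pred n)) #0 ]
    S ≈ (A - B) * recip (fromℕ 2 * i * z ^ (2 ℕ.^ pred n)) p)
theorem2p6 R zero {{()}}
theorem2p6 R (suc m) z re≢0 pole-free ω₁ ω₃ pow₁ pow₃ = Series.φ-recursion R m z re≢0 pole-free ω₁ ω₃ pow₁ pow₃
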